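{- Let $s=(s_1,\ldots,s_n)$ be any sequence of positive integers. Then the $s$-derangement polynomial $d_n^s(z)$ is real-rooted, and hence log-concave and unimodal.
   Context: For a lattice $d$-simplex $\Delta=\mathrm{conv}(v^{(0)},\ldots,v^{(d)})\subset\mathbb{R}^n$, its open parallelepiped is $\Pi^\circ_\Delta=\{\sum_{i=0}^d\lambda_i(v^{(i)},1)\in\mathbb{R}^{n+1}: 0<\lambda_i<1\}$, and its local $h^\ast$-polynomial (box polynomial) is $\ell^\ast(\Delta;z)=\sum_{x\in\Pi^\circ_\Delta\cap\mathbb{Z}^{n+1}}z^{x_{n+1}}$. For a sequence of positive integers $s=(s_1,\ldots,s_n)$, the $s$-lecture hall simplex is $P_n^s=\{x\in\mathbb{R}^n: 0\le x_1/s_1\le x_2/s_2\le\cdots\le x_n/s_n\le 1\}$, and the $s$-derangement polynomial is $d_n^s(z):=\ell^\ast(P_n^s;z)$. A polynomial is real-rooted if all its zeros are real or it is identically zero. -}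

module Defs where

open import Algebra.Bundles using (CommutativeRing)
open import Data.Fin.Base using (Fin; zero; suc; fromℕ; inject₁)
open import Data.Integer.Base as ℤ using (ℤ; +_; +0)
import Data.Integer.Properties as ℤₚ
open import Data.List.Base as List using (List; []; _∷_; _++_)
open import Data.List.Membership.Propositional using (_∈_)
open import Data.List.Membership.Propositional.Properties
  using (∈-map⁺; ∈-upTo⁺; ∈-filter⁺; ∈-filter⁻; ∈-cartesianProductWith⁺)
open import Data.List.Relation.Unary.Any using (here)
open import Data.List.Relation.Unary.All using ([])
open import Data.List.Relation.Unary.AllPairs using ([]; _∷_)
open import Data.List.Relation.Unary.Linked using (Linked; [-]; _∷_; linked?)
open import Data.List.Relation.Unary.Unique.Propositional using (Unique)
import Data.List.Relation.Unary.Unique.Propositional.Properties as Uniqueₚ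
open import Data.Nat.Base as ℕ using (ℕ; zero; suc; NonZero)
import Data.Nat.Properties as ℕₚ
open import Data.Product.Base using (∃; _×_; _,_; proj₁; proj₂)
open import Data.Rational.Base as ℚ using (ℚ; 0ℚ; 1ℚ; ½; ∣_∣; NonNegative)
import Data.Rational.Properties as ℚₚ
open import Data.Rational.Unnormalised.Base as ℚᵘ using (mkℚᵘ; *≡*)
import Data.Rational.Unnormalised.Properties as ℚᵘₚ
open import Data.Rational.Solver using (module +-*-Solver)
open import Data.Sum.Base using (_⊎_; inj₁; inj₂)
open import Data.Vec.Base as Vec using (Vec; []; _∷_; _∷ʳ_; lookup)
import Data.Vec.Properties as Vecₚ
open import Data.Vec.Functional using (Vector; head; tail)
open import Function.Base using (_∘_)
open import Function.Bundles using (_⇔_; mk⇔)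
open import Level using (0ℓ)
open import Relation.Binary.PropositionalEquality as ≡
  using (_≡_; refl; cong; cong₂; subst; subst₂)
open import Relation.Binary.Structures using (IsEquivalence)
open import Relation.Nullary.Decidable using (Dec; _×-dec_)
open import Relation.Unary using (Pred)

-- Real numbers are Cauchy sequences of rationals, and two are equal when their difference
-- is a null sequence.

Eventually : Pred ℕ 0ℓ → Set
Eventually P = ∃ λ N → ∀ {n} → N ℕ.≤ n → P n

Cauchy : Pred (ℕ → ℚ) 0ℓ
Cauchy a = ∀ {ε} → 0ℚ ℚ.< ε →
           ∃ λ N → ∀ {m n} → N ℕ.≤ m → N ℕ.≤ n → ∣ a m ℚ.- a n ∣ ℚ.< ε

record ℝ : Set where
  no-eta-equality
  constructor mkℝ
  field
    seq    : ℕ → ℚ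
    cauchy : Cauchy seq

open ℝ public

infix 4 _≈_ _<_ _≤_

record _≈_ (x y : ℝ) : Set where
  constructor mk≈
  field close : ∀ {ε} → 0ℚ ℚ.< ε → Eventually λ n → ∣ seq x n ℚ.- seq y n ∣ ℚ.< ε

record _<_ (x y : ℝ) : Set where
  constructor mk<
  field
    {gap} : ℚ
    gap>0 : 0ℚ ℚ.< gap
    apart : Eventually λ n → seq x n ℚ.+ gap ℚ.< seq y n

record _≤_ (x y : ℝ) : Set where
  constructor mk≤
  field below : ∀ {ε} → 0ℚ ℚ.< ε → Eventually λ n → seq x n ℚ.< seq y n ℚ.+ ε

open _≈_ public
open _<_ public
open _≤_ public

open +-*-Solver using (solve; _:=_; _:+_; _:*_; _:-_; :-_)

module Estimates where

  ⊔≤ˡ = ℕₚ.m⊔n≤o⇒m≤o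
  ⊔≤ʳ = ℕₚ.m⊔n≤o⇒n≤o

  both : ∀ {P Q R : Pred ℕ 0ℓ} → (∀ {n} → P n → Q n → R n) →
         Eventually P → Eventually Q → Eventually R
  both f (M , p) (N , q) = M ℕ.⊔ N , λ h → f (p (⊔≤ˡ M N h)) (q (⊔≤ʳ M N h))

  0<½* : ∀ {ε} → 0ℚ ℚ.< ε → 0ℚ ℚ.< ½ ℚ.* ε
  0<½* {ε} ε>0 = ℚₚ.positive⁻¹ (½ ℚ.* ε) {{ℚₚ.pos*pos⇒pos ½ ε {{ℚ.positive ε>0}}}}

  ½+½ : ∀ ε → ½ ℚ.* ε ℚ.+ ½ ℚ.* ε ≡ ε
  ½+½ ε = ≡.trans (≡.sym (ℚₚ.*-distribʳ-+ ε ½ ½)) (ℚₚ.*-identityˡ ε)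

  ∣-∣-sym : ∀ a b → ∣ a ℚ.- b ∣ ≡ ∣ b ℚ.- a ∣
  ∣-∣-sym a b = ≡.trans (≡.sym (ℚₚ.∣-p∣≡∣p∣ (a ℚ.- b)))
    (cong ∣_∣ (solve 2 (λ a b → :- (a :- b) := b :- a) refl a b))

  p≤∣p∣ : ∀ p → p ℚ.≤ ∣ p ∣
  p≤∣p∣ p with ℚₚ.≤-total 0ℚ p
  ... | inj₁ 0≤p = ℚₚ.≤-reflexive (≡.sym (ℚₚ.0≤p⇒∣p∣≡p 0≤p))
  ... | inj₂ p≤0 = ℚₚ.≤-trans p≤0 (ℚₚ.0≤∣p∣ p)

  ∣-∣-triangle : ∀ a b c → ∣ a ℚ.- c ∣ ℚ.≤ ∣ a ℚ.- b ∣ ℚ.+ ∣ b ℚ.- c ∣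
  ∣-∣-triangle a b c = subst (ℚ._≤ ∣ a ℚ.- b ∣ ℚ.+ ∣ b ℚ.- c ∣)
    (cong ∣_∣ (solve 3 (λ a b c → (a :- b) :+ (b :- c) := a :- c) refl a b c))
    (ℚₚ.∣p+q∣≤∣p∣+∣q∣ (a ℚ.- b) (b ℚ.- c))

  halves : ∀ {p a b ε} → p ℚ.≤ a ℚ.+ b → a ℚ.< ½ ℚ.* ε → b ℚ.< ½ ℚ.* ε → p ℚ.< ε
  halves {ε = ε} p≤ a< b< =
    ℚₚ.≤-<-trans p≤ (subst (_ ℚ.<_) (½+½ ε) (ℚₚ.+-mono-< a< b<))

  +-close : ∀ a b c d {ε} → ∣ a ℚ.- c ∣ ℚ.< ½ ℚ.* ε → ∣ b ℚ.- d ∣ ℚ.< ½ ℚ.* ε →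
            ∣ (a ℚ.+ b) ℚ.- (c ℚ.+ d) ∣ ℚ.< ε
  +-close a b c d = halves (subst (ℚ._≤ ∣ a ℚ.- c ∣ ℚ.+ ∣ b ℚ.- d ∣)
    (cong ∣_∣ (solve 4 (λ a b c d → (a :- c) :+ (b :- d) := (a :+ b) :- (c :+ d)) refl a b c d))
    (ℚₚ.∣p+q∣≤∣p∣+∣q∣ (a ℚ.- c) (b ℚ.- d)))

  -‿close : ∀ a c → ∣ (ℚ.- a) ℚ.- (ℚ.- c) ∣ ≡ ∣ a ℚ.- c ∣
  -‿close a c = ≡.trans (≡.sym (ℚₚ.∣-p∣≡∣p∣ _))
    (cong ∣_∣ (solve 2 (λ a c → :- ((:- a) :- (:- c)) := a :- c) refl a c))

  scaled : ∀ {ε} A → 0ℚ ℚ.< A → 0ℚ ℚ.< ε →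
           ∃ λ δ → 0ℚ ℚ.< δ × A ℚ.* δ ≡ ½ ℚ.* ε
  scaled {ε} A A>0 ε>0 = 1/A ℚ.* (½ ℚ.* ε)
    , ℚₚ.positive⁻¹ _ {{ℚₚ.pos*pos⇒pos 1/A {{ℚₚ.1/pos⇒pos A {{A+}}}} (½ ℚ.* ε) {{ℚ.positive (0<½* ε>0)}}}}
    , ≡.trans (≡.sym (ℚₚ.*-assoc A 1/A _))
        (≡.trans (cong (ℚ._* (½ ℚ.* ε)) (ℚₚ.*-inverseʳ A {{A≠0}})) (ℚₚ.*-identityˡ _))
    where
    A+  = ℚ.positive A>0
    A≠0 = ℚ.>-nonZero A>0
    1/A = (ℚ.1/ A) {{A≠0}}

  ∣*∣-bound : ∀ p q {A δ} → ∣ p ∣ ℚ.< A → ∣ q ∣ ℚ.< δ → ∣ p ℚ.* q ∣ ℚ.≤ A ℚ.* δ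
  ∣*∣-bound p q {A} {δ} p<A q<δ = subst (ℚ._≤ A ℚ.* δ) (≡.sym (ℚₚ.∣p*q∣≡∣p∣*∣q∣ p q))
    (ℚₚ.≤-trans
      (ℚₚ.*-monoʳ-≤-nonNeg ∣ q ∣ {{ℚₚ.∣-∣-nonNeg q}} (ℚₚ.<⇒≤ p<A))
      (ℚₚ.*-monoˡ-≤-nonNeg A {{ℚ.nonNegative (ℚₚ.≤-trans (ℚₚ.0≤∣p∣ p) (ℚₚ.<⇒≤ p<A))}}
        (ℚₚ.<⇒≤ q<δ)))

  *-close : ∀ a b c d {A D δ₁ δ₂ ε} → 0ℚ ℚ.< ε →
            A ℚ.* δ₁ ≡ ½ ℚ.* (½ ℚ.* ε) → D ℚ.* δ₂ ≡ ½ ℚ.* (½ ℚ.* ε) →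
            ∣ a ∣ ℚ.< A → ∣ d ∣ ℚ.< D → ∣ b ℚ.- d ∣ ℚ.< δ₁ → ∣ a ℚ.- c ∣ ℚ.< δ₂ →
            ∣ a ℚ.* b ℚ.- c ℚ.* d ∣ ℚ.< ε
  *-close a b c d {A} {D} {δ₁} {δ₂} {ε} ε>0 e₁ e₂ a<A d<D b-d a-c =
    ℚₚ.≤-<-trans
      (subst (ℚ._≤ A ℚ.* δ₁ ℚ.+ D ℚ.* δ₂)
        (cong ∣_∣ (solve 4 (λ a b c d → a :* (b :- d) :+ d :* (a :- c) := a :* b :- c :* d) refl a b c d))
        (ℚₚ.≤-trans (ℚₚ.∣p+q∣≤∣p∣+∣q∣ (a ℚ.* (b ℚ.- d)) (d ℚ.* (a ℚ.- c)))
          (ℚₚ.+-mono-≤ (∣*∣-bound a (b ℚ.- d) a<A b-d) (∣*∣-bound d (a ℚ.- c) d<D a-c))))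
      (subst (ℚ._< ε) (≡.sym (≡.trans (cong₂ ℚ._+_ e₁ e₂) (½+½ (½ ℚ.* ε)))) half<)
    where
    half< : ½ ℚ.* ε ℚ.< ε
    half< = subst₂ ℚ._<_ (ℚₚ.+-identityʳ _) (½+½ ε) (ℚₚ.+-monoʳ-< (½ ℚ.* ε) (0<½* ε>0))

  bounded : ∀ x → ∃ λ A → 0ℚ ℚ.< A × Eventually λ n → ∣ seq x n ∣ ℚ.< A
  bounded x with cauchy x {1ℚ} (ℚₚ.positive⁻¹ 1ℚ)
  ... | N , c = ∣ a ∣ ℚ.+ 1ℚ
              , ℚₚ.positive⁻¹ _ {{ℚₚ.nonNeg+pos⇒pos ∣ a ∣ {{ℚₚ.∣-∣-nonNeg a}} 1ℚ}}
              , N , λ {n} h → ℚₚ.≤-<-trans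
                  (subst (λ p → ∣ p ∣ ℚ.≤ ∣ a ∣ ℚ.+ ∣ seq x n ℚ.- a ∣)
                    (solve 2 (λ a b → a :+ (b :- a) := b) refl a (seq x n))
                    (ℚₚ.∣p+q∣≤∣p∣+∣q∣ a (seq x n ℚ.- a)))
                  (ℚₚ.+-monoʳ-< ∣ a ∣ (c h ℕₚ.≤-refl))
    where a = seq x N

  abstract
    +-cauchy : ∀ x y → Cauchy λ n → seq x n ℚ.+ seq y n
    +-cauchy x y ε>0 =
      let M , p = cauchy x (0<½* ε>0)
          N , q = cauchy y (0<½* ε>0)
      in M ℕ.⊔ N , λ {m} {n} h k →
           +-close (seq x m) (seq y m) (seq x n) (seq y n) 
             (p (⊔≤ˡ M N h) (⊔≤ˡ M N k)) (q (⊔≤ʳ M N h) (⊔≤ʳ M N k))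

    -‿cauchy : ∀ x → Cauchy λ n → ℚ.- seq x n
    -‿cauchy x ε>0 =
      let N , p = cauchy x ε>0
      in N , λ {m} {n} h k →
           subst (ℚ._< _) (≡.sym (-‿close (seq x m) (seq x n))) (p h k)

    *-cauchy : ∀ x y → Cauchy λ n → seq x n ℚ.* seq y n
    *-cauchy x y ε>0 =
      let A , A>0 , K , a = bounded x
          D , D>0 , L , d = bounded y
          δ₁ , δ₁>0 , e₁ = scaled A A>0 (0<½* ε>0)
          δ₂ , δ₂>0 , e₂ = scaled D D>0 (0<½* ε>0)
          M , p = cauchy x δ₂>0
          N , q = cauchy y δ₁>0
      in (K ℕ.⊔ L) ℕ.⊔ (M ℕ.⊔ N) , λ {m} {n} h k →
           *-close (seq x m) (seq y m) (seq x n) (seq y n) ε>0 e₁ e₂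
             (a (⊔≤ˡ K L (⊔≤ˡ (K ℕ.⊔ L) (M ℕ.⊔ N) h))) (d (⊔≤ʳ K L (⊔≤ˡ (K ℕ.⊔ L) (M ℕ.⊔ N) k)))
             (q (⊔≤ʳ M N (⊔≤ʳ (K ℕ.⊔ L) (M ℕ.⊔ N) h)) (⊔≤ʳ M N (⊔≤ʳ (K ℕ.⊔ L) (M ℕ.⊔ N) k)))
             (p (⊔≤ˡ M N (⊔≤ʳ (K ℕ.⊔ L) (M ℕ.⊔ N) h)) (⊔≤ˡ M N (⊔≤ʳ (K ℕ.⊔ L) (M ℕ.⊔ N) k)))

    const-cauchy : ∀ q → Cauchy λ _ → q
    const-cauchy q {ε} ε>0 = 0 , λ _ _ →
      subst (ℚ._< ε) (≡.sym (cong ∣_∣ (ℚₚ.+-inverseʳ q))) ε>0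

open Estimates

infix  8 -_
infixl 7 _*_ _÷_
infixl 6 _+_ _-_

_+_ : ℝ → ℝ → ℝ
x + y = mkℝ (λ n → seq x n ℚ.+ seq y n) (+-cauchy x y)

-_ : ℝ → ℝ
- x = mkℝ (λ n → ℚ.- seq x n) (-‿cauchy x)

_-_ : ℝ → ℝ → ℝ
x - y = x + - y

_*_ : ℝ → ℝ → ℝ
x * y = mkℝ (λ n → seq x n ℚ.* seq y n) (*-cauchy x y)

fromℚ : ℚ → ℝ
fromℚ q = mkℝ (λ _ → q) (const-cauchy q)

fromℤ : ℤ → ℝ
fromℤ i = fromℚ (i ℚ./ 1)

0ℝ 1ℝ : ℝ
0ℝ = fromℚ 0ℚ
1ℝ = fromℚ 1ℚ

module Congruence where

  pointwise : ∀ {x y} → (∀ n → seq x n ≡ seq y n) → x ≈ y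
  pointwise {x} {y} e = mk≈ λ {ε} ε>0 → 0 , λ {n} _ → subst (ℚ._< ε)
    (≡.sym (cong ∣_∣ (≡.trans (cong (ℚ._- seq y n) (e n)) (ℚₚ.+-inverseʳ (seq y n))))) ε>0

  +-cong : ∀ {x y u v} → x ≈ y → u ≈ v → x + u ≈ y + v
  +-cong {x} {y} {u} {v} x≈y u≈v = mk≈ λ ε>0 →
    both (λ {n} → +-close (seq x n) (seq u n) (seq y n) (seq v n))
      (close x≈y (0<½* ε>0)) (close u≈v (0<½* ε>0))

  *-cong : ∀ {x y u v} → x ≈ y → u ≈ v → x * u ≈ y * v
  *-cong {x} {y} {u} {v} x≈y u≈v = mk≈ λ ε>0 →
    let A , A>0 , a = bounded x
        D , D>0 , d = bounded v
        δ₁ , δ₁>0 , e₁ = scaled A A>0 (0<½* ε>0)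
        δ₂ , δ₂>0 , e₂ = scaled D D>0 (0<½* ε>0)
    in both (λ {n} (p , q) (r , s) →
               *-close (seq x n) (seq u n) (seq y n) (seq v n) ε>0 e₁ e₂ p q r s)
         (both _,_ a d) (both _,_ (close u≈v δ₁>0) (close x≈y δ₂>0))

  -‿cong : ∀ {x y} → x ≈ y → - x ≈ - y
  -‿cong {x} {y} x≈y = mk≈ λ ε>0 → let N , p = close x≈y ε>0 in
    N , λ {n} h → subst (ℚ._< _) (≡.sym (-‿close (seq x n) (seq y n))) (p h)

open Congruence

≈-isEquivalence : IsEquivalence _≈_
≈-isEquivalence = record
  { refl  = pointwise (λ _ → refl)
  ; sym   = λ {x} {y} x≈y → mk≈ λ {ε} ε>0 → let N , p = close x≈y ε>0 in
      N , λ {n} h → subst (ℚ._< ε) (∣-∣-sym (seq x n) (seq y n)) (p h)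
  ; trans = λ {x} {y} {z} x≈y y≈z → mk≈ λ ε>0 →
      both (λ {n} → halves (∣-∣-triangle (seq x n) (seq y n) (seq z n)))
        (close x≈y (0<½* ε>0)) (close y≈z (0<½* ε>0))
  }

ℝ-commutativeRing : CommutativeRing 0ℓ 0ℓ
ℝ-commutativeRing = record
  { Carrier = ℝ ; _≈_ = _≈_ ; _+_ = _+_ ; _*_ = _*_ ; -_ = -_ ; 0# = 0ℝ ; 1# = 1ℝ
  ; isCommutativeRing = record
    { isRing = record
      { +-isAbelianGroup = record
        { isGroup = record
          { isMonoid = record
            { isSemigroup = record
              { isMagma = record
                { isEquivalence = ≈-isEquivalence
                ; ∙-cong = +-cong
                }
              ; assoc = λ x y z → pointwise λ n → ℚₚ.+-assoc (seq x n) (seq y n) (seq z n)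
              }
            ; identity = (λ x → pointwise λ n → ℚₚ.+-identityˡ (seq x n))
                       , (λ x → pointwise λ n → ℚₚ.+-identityʳ (seq x n))
            }
          ; inverse = (λ x → pointwise λ n → ℚₚ.+-inverseˡ (seq x n))
                    , (λ x → pointwise λ n → ℚₚ.+-inverseʳ (seq x n))
          ; ⁻¹-cong = -‿cong
          }
        ; comm = λ x y → pointwise λ n → ℚₚ.+-comm (seq x n) (seq y n)
        }
      ; *-cong = *-cong
      ; *-assoc = λ x y z → pointwise λ n → ℚₚ.*-assoc (seq x n) (seq y n) (seq z n)
      ; *-identity = (λ x → pointwise λ n → ℚₚ.*-identityˡ (seq x n))
                   , (λ x → pointwise λ n → ℚₚ.*-identityʳ (seq x n))
      ; distrib = (λ x y z → pointwise λ n → ℚₚ.*-distribˡ-+ (seq x n) (seq y n) (seq z n))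
                , (λ x y z → pointwise λ n → ℚₚ.*-distribʳ-+ (seq x n) (seq y n) (seq z n))
      }
    ; *-comm = λ x y → pointwise λ n → ℚₚ.*-comm (seq x n) (seq y n)
    }
  }

open import Algebra.Properties.Monoid.Sum (CommutativeRing.+-monoid ℝ-commutativeRing) public
  using (sum)

record ℕ⁺ : Set where
  constructor pos
  field
    value         : ℕ
    .{{nonZero}}  : NonZero value

open ℕ⁺ public using (value)

1⁺ : ℕ⁺
1⁺ = pos 1

1/_ : ℕ⁺ → ℚ
1/ pos m = + 1 ℚ./ m

toℤ : ℕ⁺ → ℤ
toℤ m = + value m

_÷_ : ℝ → ℕ⁺ → ℝ
x ÷ m = x * fromℚ (1/ m)

conv : ∀ {m n} → Vector (Vec ℤ n) m → Pred (Vector ℝ n) 0ℓ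
conv {m} v x = ∃ λ (c : Vector ℝ m) →
  (∀ j → 0ℝ ≤ c j) × sum c ≈ 1ℝ ×
  (∀ k → x k ≈ sum λ j → c j * fromℤ (lookup (v j) k))

AffinelyIndependent : ∀ {m n} → Vector (Vec ℤ n) m → Set
AffinelyIndependent {m} v = ∀ (c : Vector ℝ m) → sum c ≈ 0ℝ →
  (∀ k → sum (λ j → c j * fromℤ (lookup (v j) k)) ≈ 0ℝ) → ∀ j → c j ≈ 0ℝ

record IsLatticeSimplex (d : ℕ) {n} (Δ : Pred (Vector ℝ n) 0ℓ) : Set where
  field
    vertex      : Vector (Vec ℤ n) (suc d)
    independent : AffinelyIndependent vertex
    hull        : ∀ x → Δ x ⇔ conv vertex x

Π° : ∀ {m n} → Vector (Vec ℤ n) m → Pred (Vector ℝ (suc n)) 0ℓ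
Π° {m} v x = ∃ λ (c : Vector ℝ m) →
  (∀ j → 0ℝ < c j × c j < 1ℝ) ×
  (∀ k → x k ≈ sum λ j → c j * fromℤ (lookup (v j ∷ʳ + 1) k))

latticePoint : ∀ {n} → Vec ℤ n → Vector ℝ n
latticePoint z k = fromℤ (lookup z k)

record Enumeration {A : Set} (P : Pred A 0ℓ) : Set where
  field
    elements : List A
    unique   : Unique elements
    sound    : ∀ {a} → a ∈ elements → P a
    complete : ∀ {a} → P a → a ∈ elements

-- Coefficient lists, constant term first; trailing zeros are allowed.

Polynomial : Set
Polynomial = List ℕ

coeff : Polynomial → ℕ → ℕ
coeff []      _       = 0
coeff (a ∷ p) zero    = a
coeff (a ∷ p) (suc k) = coeff p k

_⊕_ : Polynomial → Polynomial → Polynomial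
[]      ⊕ q       = q
(a ∷ p) ⊕ []      = a ∷ p
(a ∷ p) ⊕ (b ∷ q) = (a ℕ.+ b) ∷ (p ⊕ q)

z^_ : ℕ → Polynomial
z^ k = List.replicate k 0 ++ 1 ∷ []

-- The polynomial does not depend on the order in which the points are enumerated. The
-- last coordinate of a point of Π° is a sum of positive numbers, so taking its absolute
-- value as the exponent loses nothing.

ℓ* : ∀ {d n} {Δ : Pred (Vector ℝ n) 0ℓ} (S : IsLatticeSimplex d Δ) →
     Enumeration (Π° (IsLatticeSimplex.vertex S) ∘ latticePoint) → Polynomial
ℓ* S E = List.foldr (λ z p → (z^ ℤ.∣ Vec.last z ∣) ⊕ p) [] (Enumeration.elements E)

lectureHall : ∀ {n} → Vec ℕ⁺ n → Pred (Vector ℝ n) 0ℓ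
lectureHall s x = Linked _≤_ (0ℝ ∷ List.tabulate (λ k → x k ÷ lookup s k) ++ 1ℝ ∷ [])

-- The j-th vertex is (0, …, 0, s_{j+1}, …, s_n), for j = 0, …, n.

lectureHallVertex : ∀ {n} → Vec ℕ⁺ n → Vector (Vec ℤ n) (suc n)
lectureHallVertex s       zero    = Vec.map toℤ s
lectureHallVertex (_ ∷ s) (suc j) = +0 ∷ lectureHallVertex s j

open CommutativeRing ℝ-commutativeRing using ()
  renaming ( refl to ≈-refl; sym to ≈-sym; trans to ≈-trans; reflexive to ≈-reflexive
           ; +-assoc to +ℝ-assoc; +-identityʳ to +ℝ-identityʳ; +-identityˡ to +ℝ-identityˡ
           ; *-comm to *ℝ-comm; zeroʳ to *ℝ-zeroʳ; distribˡ to *ℝ-distribˡ-+ )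

module Geometry where

  *-1/ : ∀ m → (toℤ m ℚ./ 1) ℚ.* (1/ m) ≡ 1ℚ
  *-1/ m@(pos (suc k)) = ℚₚ.toℚᵘ-injective (ℚᵘₚ.≃-trans
    (ℚₚ.toℚᵘ-homo-* (toℤ m ℚ./ 1) (1/ m))
    (ℚᵘₚ.≃-trans
      (ℚᵘₚ.*-cong (ℚₚ.toℚᵘ-fromℚᵘ (mkℚᵘ (+ suc k) 0)) (ℚₚ.toℚᵘ-fromℚᵘ (mkℚᵘ (+ 1) k)))
      (*≡* (cong +_ (lemma k)))))
    where
    lemma : ∀ k → suc k ℕ.* 1 ℕ.* 1 ≡ 1 ℕ.* suc (k ℕ.+ 0)
    lemma k = ≡.trans (ℕₚ.*-identityʳ _) (≡.trans (ℕₚ.*-identityʳ _)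
      (cong suc (≡.trans (≡.sym (ℕₚ.+-identityʳ k)) (≡.sym (ℕₚ.+-identityʳ _)))))

  0<1/ : ∀ m → 0ℚ ℚ.< 1/ m
  0<1/ m@(pos (suc k)) = ℚₚ.positive⁻¹ (1/ m) {{ℚₚ.normalize-pos 1 (suc k)}}

  toℚᵘ-int : ∀ i → ℚ.toℚᵘ (i ℚ./ 1) ℚᵘ.≃ mkℚᵘ i 0
  toℚᵘ-int i = ℚₚ.toℚᵘ-fromℚᵘ (mkℚᵘ i 0)

  int-* : ∀ i j → (i ℚ./ 1) ℚ.* (j ℚ./ 1) ≡ (i ℤ.* j) ℚ./ 1
  int-* i j = ℚₚ.toℚᵘ-injective (ℚᵘₚ.≃-trans (ℚₚ.toℚᵘ-homo-* (i ℚ./ 1) (j ℚ./ 1))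
    (ℚᵘₚ.≃-trans (ℚᵘₚ.*-cong (toℚᵘ-int i) (toℚᵘ-int j)) (ℚᵘₚ.≃-sym (toℚᵘ-int (i ℤ.* j)))))

  int-suc : ∀ k → (+ k ℚ./ 1) ℚ.+ 1ℚ ≡ + suc k ℚ./ 1
  int-suc k = ℚₚ.toℚᵘ-injective (ℚᵘₚ.≃-trans (ℚₚ.toℚᵘ-homo-+ (+ k ℚ./ 1) 1ℚ)
    (ℚᵘₚ.≃-trans (ℚᵘₚ.+-congˡ (ℚ.toℚᵘ 1ℚ) (toℚᵘ-int (+ k)))
      (ℚᵘₚ.≃-trans (*≡* (cong (ℤ._* + 1) (≡.trans (cong (ℤ._+ + 1) (ℤₚ.*-identityʳ (+ k)))
                          (cong +_ (ℕₚ.+-comm k 1)))))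
        (ℚᵘₚ.≃-sym (toℚᵘ-int (+ suc k))))))

  int-<⁻ : ∀ {i j} → i ℚ./ 1 ℚ.< j ℚ./ 1 → i ℤ.< j
  int-<⁻ {i} {j} i<j with ℚᵘₚ.<-respˡ-≃ (toℚᵘ-int i) (ℚᵘₚ.<-respʳ-≃ (toℚᵘ-int j) (ℚₚ.toℚᵘ-mono-< i<j))
  ... | ℚᵘ.*<* h = subst₂ ℤ._<_ (ℤₚ.*-identityʳ i) (ℤₚ.*-identityʳ j) h

  ∣p∣<⇒p< : ∀ {p ε} → ∣ p ∣ ℚ.< ε → p ℚ.< ε
  ∣p∣<⇒p< {p} = ℚₚ.≤-<-trans (p≤∣p∣ p)

  shift-< : ∀ {a b c} → a ℚ.- b ℚ.< c → a ℚ.< b ℚ.+ c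
  shift-< {a} {b} {c} h = subst (ℚ._< b ℚ.+ c)
    (solve 2 (λ a b → b :+ (a :- b) := a) refl a b) (ℚₚ.+-monoʳ-< b h)

  cancel-+-< : ∀ r {p q} → p ℚ.+ r ℚ.< q ℚ.+ r → p ℚ.< q
  cancel-+-< r {p} {q} h = subst₂ ℚ._<_ (eq p) (eq q) (ℚₚ.+-monoˡ-< (ℚ.- r) h)
    where
    eq : ∀ a → a ℚ.+ r ℚ.- r ≡ a
    eq a = solve 2 (λ a r → a :+ r :- r := a) refl a r

  ≈⇒≤ : ∀ {x y} → x ≈ y → x ≤ y
  ≈⇒≤ x≈y = mk≤ λ ε>0 → let N , p = close x≈y ε>0 in
    N , λ h → shift-< (∣p∣<⇒p< (p h))

  ≤-trans : ∀ {x y z} → x ≤ y → y ≤ z → x ≤ z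
  ≤-trans {x} {y} {z} x≤y y≤z = mk≤ λ {ε} ε>0 →
    both (λ {n} p q → ℚₚ.<-trans p (subst (seq y n ℚ.+ ½ ℚ.* ε ℚ.<_)
           (≡.trans (ℚₚ.+-assoc (seq z n) _ _) (cong (seq z n ℚ.+_) (½+½ ε)))
           (ℚₚ.+-monoˡ-< (½ ℚ.* ε) q)))
      (below x≤y (0<½* ε>0)) (below y≤z (0<½* ε>0))

  <-≤-trans : ∀ {x y z} → x < y → y ≤ z → x < z
  <-≤-trans {x} {y} {z} (mk< {γ} γ>0 x<y) y≤z = mk< (0<½* γ>0)
    (both (λ {n} p q → cancel-+-< (½ ℚ.* γ) (ℚₚ.<-trans (subst (ℚ._< seq y n)
             (≡.sym (≡.trans (ℚₚ.+-assoc (seq x n) _ _) (cong (seq x n ℚ.+_) (½+½ γ)))) p) q))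
      x<y (below y≤z (0<½* γ>0)))

  ≤-<-trans : ∀ {x y z} → x ≤ y → y < z → x < z
  ≤-<-trans {x} {y} {z} x≤y (mk< {γ} γ>0 y<z) = mk< (0<½* γ>0)
    (both (λ {n} p q → ℚₚ.<-trans (subst (seq x n ℚ.+ ½ ℚ.* γ ℚ.<_)
             (≡.trans (ℚₚ.+-assoc (seq y n) _ _) (cong (seq y n ℚ.+_) (½+½ γ)))
             (ℚₚ.+-monoˡ-< (½ ℚ.* γ) p)) q)
      (below x≤y (0<½* γ>0)) y<z)

  +-monoʳ-< : ∀ z {x y} → x < y → z + x < z + y
  +-monoʳ-< z {x} {y} (mk< {γ} γ>0 (N , p)) = mk< γ>0 (N , λ {n} h →
    subst (ℚ._< seq z n ℚ.+ seq y n) (≡.sym (ℚₚ.+-assoc (seq z n) (seq x n) γ))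
      (ℚₚ.+-monoʳ-< (seq z n) (p h)))

  +-monoʳ-≤ : ∀ z {x y} → x ≤ y → z + x ≤ z + y
  +-monoʳ-≤ z {x} {y} x≤y = mk≤ λ {ε} ε>0 → let N , p = below x≤y ε>0 in N , λ {n} h →
    subst (seq z n ℚ.+ seq x n ℚ.<_) (≡.sym (ℚₚ.+-assoc (seq z n) (seq y n) ε))
      (ℚₚ.+-monoʳ-< (seq z n) (p h))

  fromℚ-< : ∀ {p q} → p ℚ.< q → fromℚ p < fromℚ q
  fromℚ-< {p} {q} p<q = mk< (0<½* γ>0) (0 , λ _ →
      subst₂ ℚ._<_ (ℚₚ.+-identityʳ _) eq (ℚₚ.+-monoʳ-< (p ℚ.+ ½ ℚ.* γ) (0<½* γ>0)))
    where
    γ = q ℚ.- p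
    γ>0 : 0ℚ ℚ.< γ
    γ>0 = subst (ℚ._< γ) (ℚₚ.+-inverseʳ p) (ℚₚ.+-monoˡ-< (ℚ.- p) p<q)
    eq : p ℚ.+ ½ ℚ.* γ ℚ.+ ½ ℚ.* γ ≡ q
    eq = ≡.trans (ℚₚ.+-assoc p _ _) (≡.trans (cong (p ℚ.+_) (½+½ γ))
           (solve 2 (λ p q → p :+ (q :- p) := q) refl p q))

  fromℚ-<⁻ : ∀ {p q} → fromℚ p < fromℚ q → p ℚ.< q
  fromℚ-<⁻ {p} {q} (mk< {γ} γ>0 (N , h)) = ℚₚ.<-trans
    (subst (ℚ._< p ℚ.+ γ) (ℚₚ.+-identityʳ p) (ℚₚ.+-monoʳ-< p γ>0)) (h {N} ℕₚ.≤-refl)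

  +-shift : ∀ r {x y} → y ≈ r + x → x ≈ y - r
  +-shift r {x} {y} e = ≈-trans
    (pointwise {x} {(r + x) - r} λ n → solve 2 (λ r x → x := (r :+ x) :- r) refl (seq r n) (seq x n))
    (+-cong (≈-sym e) ≈-refl)

  +-unshift : ∀ r x → r + (x - r) ≈ x
  +-unshift r x = pointwise λ n → solve 2 (λ r x → r :+ (x :- r) := x) refl (seq r n) (seq x n)

  *÷ : ∀ m x → (fromℤ (toℤ m) * x) ÷ m ≈ x
  *÷ m x = pointwise λ n → ≡.trans
    (solve 3 (λ t x u → (t :* x) :* u := (t :* u) :* x) refl (toℤ m ℚ./ 1) (seq x n) (1/ m))
    (≡.trans (cong (ℚ._* seq x n) (*-1/ m)) (ℚₚ.*-identityˡ (seq x n)))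

  ÷* : ∀ m x → fromℤ (toℤ m) * (x ÷ m) ≈ x
  ÷* m x = pointwise λ n → ≡.trans
    (solve 3 (λ t x u → t :* (x :* u) := (t :* u) :* x) refl (toℤ m ℚ./ 1) (seq x n) (1/ m))
    (≡.trans (cong (ℚ._* seq x n) (*-1/ m)) (ℚₚ.*-identityˡ (seq x n)))

  ÷-cong : ∀ m {x y} → x ≈ y → x ÷ m ≈ y ÷ m
  ÷-cong m e = *-cong e ≈-refl

  partialSum : ∀ {m} → Vector ℝ m → Vector ℝ m
  partialSum c zero    = head c
  partialSum c (suc k) = head c + partialSum (tail c) k

  partialSum-last : ∀ {n} (c : Vector ℝ (suc n)) → partialSum c (fromℕ n) ≈ sum c
  partialSum-last {zero}  c = ≈-sym (+ℝ-identityʳ (head c))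
  partialSum-last {suc n} c = +-cong ≈-refl (partialSum-last (tail c))

  sum-zero : ∀ {m} (c : Vector ℝ m) → sum (λ j → c j * fromℤ +0) ≈ 0ℝ
  sum-zero {zero}  c = ≈-refl
  sum-zero {suc m} c = ≈-trans (+-cong (*ℝ-zeroʳ (head c)) (sum-zero (tail c))) (+ℝ-identityʳ 0ℝ)

  sum-vertices : ∀ {n} (s : Vec ℕ⁺ n) (c : Vector ℝ (suc n)) k →
    sum (λ j → c j * fromℤ (lookup (lectureHallVertex s j) k)) ≈
    fromℤ (toℤ (lookup s k)) * partialSum c (inject₁ k)
  sum-vertices (m ∷ s) c zero = ≈-trans
    (+-cong (*ℝ-comm (head c) (fromℤ (toℤ m))) (sum-zero (tail c))) (+ℝ-identityʳ _)
  sum-vertices (m ∷ s) c (suc k) = ≈-trans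
    (+-cong (≈-trans (≈-reflexive (cong (λ i → head c * fromℤ i) (Vecₚ.lookup-map k toℤ s)))
                     (*ℝ-comm (head c) _))
            (sum-vertices s (tail c) k))
    (≈-sym (*ℝ-distribˡ-+ _ (head c) (partialSum (tail c) (inject₁ k))))

  sum-vertices¹ : ∀ {n} (s : Vec ℕ⁺ n) (c : Vector ℝ (suc n)) k →
    sum (λ j → c j * fromℤ (lookup (lectureHallVertex s j ∷ʳ + 1) k)) ≈
    fromℤ (toℤ (lookup (s ∷ʳ 1⁺) k)) * partialSum c k
  sum-vertices¹ [] c zero = ≈-trans (+ℝ-identityʳ _) (*ℝ-comm (head c) _)
  sum-vertices¹ (m ∷ s) c zero = ≈-trans
    (+-cong (*ℝ-comm (head c) (fromℤ (toℤ m))) (sum-zero (tail c))) (+ℝ-identityʳ _)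
  sum-vertices¹ (m ∷ s) c (suc k) = ≈-trans
    (+-cong (≈-trans (≈-reflexive (cong (λ i → head c * fromℤ i) (lookup-map¹ s k)))
                     (*ℝ-comm (head c) _))
            (sum-vertices¹ s (tail c) k))
    (≈-sym (*ℝ-distribˡ-+ _ (head c) (partialSum (tail c) k)))
    where
    lookup-map¹ : ∀ {n} (s : Vec ℕ⁺ n) k →
      lookup (Vec.map toℤ s ∷ʳ + 1) k ≡ toℤ (lookup (s ∷ʳ 1⁺) k)
    lookup-map¹ []      zero    = refl
    lookup-map¹ (_ ∷ _) zero    = refl
    lookup-map¹ (_ ∷ s) (suc k) = lookup-map¹ s k

  independent-vertices : ∀ {n} (s : Vec ℕ⁺ n) → AffinelyIndependent (lectureHallVertex s)
  independent-vertices s c Σc≈0 Σcv≈0 =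
    allZero c (λ k → cancel (lookup s k) (≈-trans (≈-sym (sum-vertices s c k)) (Σcv≈0 k)))
      (≈-trans (partialSum-last c) Σc≈0)
    where
    cancel : ∀ m {x} → fromℤ (toℤ m) * x ≈ 0ℝ → x ≈ 0ℝ
    cancel m {x} e = ≈-trans (≈-sym (*÷ m x)) (≈-trans (÷-cong m e)
      (≈-trans (*ℝ-comm 0ℝ _) (*ℝ-zeroʳ _)))
    drop : ∀ {x y} → x ≈ 0ℝ → x + y ≈ 0ℝ → y ≈ 0ℝ
    drop {x} {y} x≈0 e = ≈-trans (≈-sym (+ℝ-identityˡ y)) (≈-trans (+-cong (≈-sym x≈0) ≈-refl) e)
    allZero : ∀ {n} (c : Vector ℝ (suc n)) → (∀ k → partialSum c (inject₁ k) ≈ 0ℝ) →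
              partialSum c (fromℕ n) ≈ 0ℝ → ∀ j → c j ≈ 0ℝ
    allZero {zero}  c h l zero    = l
    allZero {suc n} c h l zero    = h zero
    allZero {suc n} c h l (suc j) =
      allZero (tail c) (λ k → drop (h zero) (h (suc k))) (drop (h zero) l) j

  increments : ∀ {n} r (y : Vector ℝ n) → Linked _≤_ (r ∷ List.tabulate y ++ 1ℝ ∷ []) →
    ∃ λ (c : Vector ℝ (suc n)) → (∀ j → 0ℝ ≤ c j) ×
      (∀ k → y k ≈ r + partialSum c (inject₁ k)) × r + partialSum c (fromℕ n) ≈ 1ℝ
  increments {zero} r y (r≤1 ∷ [-]) =
    (λ _ → 1ℝ - r) , (λ _ → step r≤1) , (λ ()) , +-unshift r 1ℝ
    where
    step : ∀ {x} → r ≤ x → 0ℝ ≤ x - r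
    step {x} r≤x = ≤-trans (≈⇒≤ (pointwise λ n → ≡.sym (ℚₚ.+-inverseˡ (seq r n))))
      (≤-trans (+-monoʳ-≤ (- r) r≤x) (≈⇒≤ (pointwise λ n → ℚₚ.+-comm (ℚ.- seq r n) (seq x n))))
  increments {suc n} r y (r≤y ∷ ys) with increments (head y) (tail y) ys
  ... | c , c≥0 , e , l = c′ , c′≥0 , e′ , ≈-trans (assoc (partialSum c (fromℕ n))) l
    where
    y₀ = head y
    c′ : Vector ℝ (suc (suc n))
    c′ zero    = y₀ - r
    c′ (suc j) = c j
    c′≥0 : ∀ j → 0ℝ ≤ c′ j
    c′≥0 zero = ≤-trans (≈⇒≤ (pointwise λ n → ≡.sym (ℚₚ.+-inverseˡ (seq r n))))
      (≤-trans (+-monoʳ-≤ (- r) r≤y) (≈⇒≤ (pointwise λ n → ℚₚ.+-comm (ℚ.- seq r n) (seq y₀ n))))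
    c′≥0 (suc j) = c≥0 j
    assoc : ∀ x → r + ((y₀ - r) + x) ≈ y₀ + x
    assoc x = ≈-trans (≈-sym (+ℝ-assoc r (y₀ - r) x)) (+-cong (+-unshift r y₀) ≈-refl)
    e′ : ∀ k → y k ≈ r + partialSum c′ (inject₁ k)
    e′ zero    = ≈-sym (+-unshift r y₀)
    e′ (suc k) = ≈-trans (e k) (≈-sym (assoc (partialSum c (inject₁ k))))

  ascending : ∀ {n} r r′ (y : Vector ℝ n) (c : Vector ℝ (suc n)) → r ≈ r′ → (∀ j → 0ℝ ≤ c j) →
    (∀ k → y k ≈ r + partialSum c (inject₁ k)) → r + partialSum c (fromℕ n) ≈ 1ℝ →
    Linked _≤_ (r′ ∷ List.tabulate y ++ 1ℝ ∷ [])
  ascending {n} r r′ y c r≈r′ c≥0 e l = go n y c c≥0 e l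
    where
    r′≤ : ∀ {x} → 0ℝ ≤ x → r′ ≤ r + x
    r′≤ 0≤x = ≤-trans (≈⇒≤ (≈-trans (≈-sym r≈r′) (≈-sym (+ℝ-identityʳ r)))) (+-monoʳ-≤ r 0≤x)
    go : ∀ n (y : Vector ℝ n) (c : Vector ℝ (suc n)) → (∀ j → 0ℝ ≤ c j) →
      (∀ k → y k ≈ r + partialSum c (inject₁ k)) → r + partialSum c (fromℕ n) ≈ 1ℝ →
      Linked _≤_ (r′ ∷ List.tabulate y ++ 1ℝ ∷ [])
    go zero    y c c≥0 e l = ≤-trans (r′≤ (c≥0 zero)) (≈⇒≤ l) ∷ [-]
    go (suc n) y c c≥0 e l = ≤-trans (r′≤ (c≥0 zero)) (≈⇒≤ (≈-sym (e zero)))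
      ∷ ascending (r + head c) (head y) (tail y) (tail c) (≈-sym (e zero)) (λ j → c≥0 (suc j))
          (λ k → ≈-trans (e (suc k)) (≈-sym (+ℝ-assoc r (head c) _)))
          (≈-trans (+ℝ-assoc r (head c) _) l)

  lectureHall-hull : ∀ {n} (s : Vec ℕ⁺ n) x → lectureHall s x ⇔ conv (lectureHallVertex s) x
  lectureHall-hull {n} s x = mk⇔ to from
    where
    to : lectureHall s x → conv (lectureHallVertex s) x
    to h with increments 0ℝ (λ k → x k ÷ lookup s k) h
    ... | c , c≥0 , e , l = c , c≥0
      , ≈-trans (≈-sym (partialSum-last c)) (≈-trans (≈-sym (+ℝ-identityˡ _)) l)
      , λ k → ≈-trans (≈-sym (÷* (lookup s k) (x k)))
                (≈-trans (*-cong ≈-refl (≈-trans (e k) (+ℝ-identityˡ _)))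
                  (≈-sym (sum-vertices s c k)))
    from : conv (lectureHallVertex s) x → lectureHall s x
    from (c , c≥0 , Σc≈1 , e) = ascending 0ℝ 0ℝ _ c ≈-refl c≥0
      (λ k → ≈-trans (÷-cong (lookup s k) (≈-trans (e k) (sum-vertices s c k)))
               (≈-trans (*÷ (lookup s k) _) (≈-sym (+ℝ-identityˡ _))))
      (≈-trans (+ℝ-identityˡ _) (≈-trans (partialSum-last c) Σc≈1))

open Geometry

lectureHallSimplex : ∀ {n} (s : Vec ℕ⁺ n) → IsLatticeSimplex n (lectureHall s)
lectureHallSimplex s = record
  { vertex      = lectureHallVertex s
  ; independent = independent-vertices s
  ; hull        = lectureHall-hull s
  }

-- With t = (s₁, …, sₙ, 1), a point z = Σ cⱼ(v⁽ʲ⁾, 1) satisfies z_k / t_k = c₀ + ⋯ + c_k,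
-- so z lies in Π° exactly when consecutive ratios increase by amounts in (0, 1).

module Points where

  Step : ℚ → ℚ → Set
  Step p q = p ℚ.< q × q ℚ.< p ℚ.+ 1ℚ

  ratio : ℤ → ℕ⁺ → ℚ
  ratio i m = (i ℚ./ 1) ℚ.* (1/ m)

  Steps : ∀ {m} → ℚ → Vec ℤ m → Vec ℕ⁺ m → Set
  Steps q z t = Linked Step (q ∷ Vec.toList (Vec.zipWith ratio z t))

  steps? : ∀ {m} q (t : Vec ℕ⁺ m) (z : Vec ℤ m) → Dec (Steps q z t)
  steps? q t z = linked? (λ p q → p ℚₚ.<? q ×-dec q ℚₚ.<? p ℚ.+ 1ℚ)
                   (q ∷ Vec.toList (Vec.zipWith ratio z t))

  toSteps : ∀ {m} (t : Vec ℕ⁺ m) (z : Vec ℤ m) (c : Vector ℝ m) q r → fromℚ q ≈ r →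
    (∀ j → 0ℝ < c j × c j < 1ℝ) →
    (∀ k → fromℚ (ratio (lookup z k) (lookup t k)) ≈ r + partialSum c k) → Steps q z t
  toSteps []      []      c q r q≈r c∈ e = [-]
  toSteps (m ∷ t) (i ∷ z) c q r q≈r c∈ e =
    ( fromℚ-<⁻ (≤-<-trans (≈⇒≤ (≈-trans q≈r (≈-sym (+ℝ-identityʳ r))))
        (<-≤-trans (+-monoʳ-< r (proj₁ (c∈ zero))) (≈⇒≤ (≈-sym (e zero)))))
    , fromℚ-<⁻ (≤-<-trans (≈⇒≤ (e zero))
        (<-≤-trans (+-monoʳ-< r (proj₂ (c∈ zero)))
          (≈⇒≤ (≈-trans (+-cong (≈-sym q≈r) ≈-refl) (pointwise λ _ → refl)))))
    ) ∷ toSteps t z (tail c) (ratio i m) (r + head c) (e zero) (λ j → c∈ (suc j))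
          (λ k → ≈-trans (e (suc k)) (≈-sym (+ℝ-assoc r (head c) _)))

  fromSteps : ∀ {m} (t : Vec ℕ⁺ m) (z : Vec ℤ m) q → Steps q z t →
    ∃ λ (c : Vector ℝ m) → (∀ j → 0ℝ < c j × c j < 1ℝ) ×
      (∀ k → fromℚ (ratio (lookup z k) (lookup t k)) ≈ fromℚ q + partialSum c k)
  fromSteps []      []      q h = (λ ()) , (λ ()) , (λ ())
  fromSteps (m ∷ t) (i ∷ z) q ((q<p , p<q+1) ∷ h) with fromSteps t z (ratio i m) h
  ... | c , c∈ , e = c′ , c′∈ , e′
    where
    p = ratio i m
    c′ : Vector ℝ _
    c′ zero    = fromℚ (p ℚ.- q)
    c′ (suc j) = c j
    c′∈ : ∀ j → 0ℝ < c′ j × c′ j < 1ℝ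
    c′∈ zero = fromℚ-< (subst (ℚ._< p ℚ.- q) (ℚₚ.+-inverseʳ q) (ℚₚ.+-monoˡ-< (ℚ.- q) q<p))
             , fromℚ-< (subst (p ℚ.- q ℚ.<_) (solve 2 (λ q o → q :+ o :- q := o) refl q 1ℚ)
                         (ℚₚ.+-monoˡ-< (ℚ.- q) p<q+1))
    c′∈ (suc j) = c∈ j
    shift : fromℚ q + fromℚ (p ℚ.- q) ≈ fromℚ p
    shift = pointwise λ _ → solve 2 (λ q p → q :+ (p :- q) := p) refl q p
    e′ : ∀ k → fromℚ (ratio (lookup (i ∷ z) k) (lookup (m ∷ t) k)) ≈ fromℚ q + partialSum c′ k
    e′ zero    = ≈-sym shift
    e′ (suc k) = ≈-trans (e k) (≈-trans (+-cong (≈-sym shift) ≈-refl) (+ℝ-assoc _ _ _))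

  -- The j-th ratio is below j, which bounds the points to be searched.

  box : ∀ {m} → ℕ → Vec ℕ⁺ m → List (Vec ℤ m)
  box k []      = [] ∷ []
  box k (m ∷ t) =
    List.cartesianProductWith _∷_ (List.map +_ (List.upTo (k ℕ.* value m))) (box (suc k) t)

  box-unique : ∀ {m} k (t : Vec ℕ⁺ m) → Unique (box k t)
  box-unique k []      = [] ∷ []
  box-unique k (m ∷ t) = Uniqueₚ.cartesianProductWith⁺ _∷_ Vecₚ.∷-injective
    (Uniqueₚ.map⁺ ℤₚ.+-injective (Uniqueₚ.upTo⁺ (k ℕ.* value m))) (box-unique (suc k) t)

  box-complete : ∀ {m} k (t : Vec ℕ⁺ m) (z : Vec ℤ m) q → 0ℚ ℚ.≤ q → q ℚ.+ 1ℚ ℚ.≤ + k ℚ./ 1 →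
                 Steps q z t → z ∈ box k t
  box-complete k []      []      q 0≤q q≤k h = here refl
  box-complete k (m ∷ t) (i ∷ z) q 0≤q q≤k ((q<p , p<q+1) ∷ h) =
    ∈-cartesianProductWith⁺ _∷_ (head∈ i 0<i i<km)
      (box-complete (suc k) t z p (ℚₚ.<⇒≤ 0<p)
        (subst (p ℚ.+ 1ℚ ℚ.≤_) (int-suc k) (ℚₚ.+-monoˡ-≤ 1ℚ (ℚₚ.<⇒≤ p<k))) h)
    where
    p = ratio i m
    0<p = ℚₚ.≤-<-trans 0≤q q<p
    p<k = ℚₚ.<-≤-trans p<q+1 q≤k
    instance
      1/m≥0 : NonNegative (1/ m)
      1/m≥0 = ℚ.nonNegative (ℚₚ.<⇒≤ (0<1/ m))
    0<i : +0 ℤ.< i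
    0<i = int-<⁻ (ℚₚ.*-cancelʳ-<-nonNeg (1/ m) (subst (ℚ._< p) (≡.sym (ℚₚ.*-zeroˡ (1/ m))) 0<p))
    i<km : i ℤ.< + (k ℕ.* value m)
    i<km = subst (i ℤ.<_) (≡.sym (ℤₚ.pos-* k (value m))) (int-<⁻ (ℚₚ.*-cancelʳ-<-nonNeg (1/ m)
      (subst (p ℚ.<_) (≡.sym (≡.trans (cong (ℚ._* (1/ m)) (≡.sym (int-* (+ k) (toℤ m))))
        (≡.trans (ℚₚ.*-assoc (+ k ℚ./ 1) _ _)
          (≡.trans (cong ((+ k ℚ./ 1) ℚ.*_) (*-1/ m)) (ℚₚ.*-identityʳ _))))) p<k)))
    head∈ : ∀ i {b} → +0 ℤ.< i → i ℤ.< + b → i ∈ List.map +_ (List.upTo b)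
    head∈ (+ a) _ (ℤ.+<+ a<b) = ∈-map⁺ +_ (∈-upTo⁺ a<b)

open Points

lectureHallPoints : ∀ {n} (s : Vec ℕ⁺ n) → Enumeration (Π° (lectureHallVertex s) ∘ latticePoint)
lectureHallPoints {n} s = record
  { elements = List.filter (steps? 0ℚ t) (box 1 t)
  ; unique   = Uniqueₚ.filter⁺ (steps? 0ℚ t) (box-unique 1 t)
  ; sound    = λ z∈ → sound (proj₂ (∈-filter⁻ (steps? 0ℚ t) {xs = box 1 t} z∈))
  ; complete = λ {z} h → ∈-filter⁺ (steps? 0ℚ t)
      (box-complete 1 t z 0ℚ ℚₚ.≤-refl ℚₚ.≤-refl (complete h)) (complete h)
  }
  where
  t = s ∷ʳ 1⁺
  sound : ∀ {z} → Steps 0ℚ z t → Π° (lectureHallVertex s) (latticePoint z)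
  sound {z} h with fromSteps t z 0ℚ h
  ... | c , c∈ , e = c , c∈ , λ k → ≈-trans (≈-sym (÷* (lookup t k) _))
    (≈-trans (*-cong ≈-refl (≈-trans (pointwise λ _ → refl) (≈-trans (e k) (+ℝ-identityˡ _))))
      (≈-sym (sum-vertices¹ s c k)))
  complete : ∀ {z} → Π° (lectureHallVertex s) (latticePoint z) → Steps 0ℚ z t
  complete {z} (c , c∈ , e) = toSteps t z c 0ℚ 0ℝ ≈-refl c∈ λ k →
    ≈-trans (pointwise λ _ → refl) (≈-trans (÷-cong (lookup t k) (≈-trans (e k) (sum-vertices¹ s c k)))
      (≈-trans (*÷ (lookup t k) _) (≈-sym (+ℝ-identityˡ _))))

derangementPolynomial : ∀ {n} → Vec ℕ⁺ n → Polynomial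
derangementPolynomial s = ℓ* (lectureHallSimplex s) (lectureHallPoints s)

record ℂ : Set where
  constructor _+i_
  field re im : ℝ

open ℂ public

infixl 7 _*ᶜ_
infixl 6 _+ᶜ_

_+ᶜ_ : ℂ → ℂ → ℂ
(a +i b) +ᶜ (c +i e) = (a + c) +i (b + e)

_*ᶜ_ : ℂ → ℂ → ℂ
(a +i b) *ᶜ (c +i e) = (a * c - b * e) +i (a * e + b * c)

eval : Polynomial → ℂ → ℂ
eval []      w = 0ℝ +i 0ℝ
eval (a ∷ p) w = (fromℤ (+ a) +i 0ℝ) +ᶜ w *ᶜ eval p w

IsZero : Polynomial → ℂ → Set
IsZero p w = re (eval p w) ≈ 0ℝ × im (eval p w) ≈ 0ℝ

RealRooted : Polynomial → Set
RealRooted p = (∀ w → IsZero p w → im w ≈ 0ℝ) ⊎ (∀ k → coeff p k ≡ 0)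

LogConcave : Polynomial → Set
LogConcave p = ∀ k → coeff p k ℕ.* coeff p (2 ℕ.+ k) ℕ.≤ coeff p (suc k) ℕ.* coeff p (suc k)

Unimodal : Polynomial → Set
Unimodal p = ∃ λ t → (∀ k → k ℕ.< t → coeff p k ℕ.≤ coeff p (suc k)) ×
                     (∀ k → t ℕ.≤ k → coeff p (suc k) ℕ.≤ coeff p k)

-- A point of the open parallelepiped is an integer sequence x whose ratios x_k / t_k, with
-- t = (s_1, …, s_n, 1), increase by amounts in (0, 1). For a coordinate with t_k = m, let v_i be the
-- sum of the monomials of the ways to continue from the ratio i / m. Then v_{i+m} = z v_i, and the
-- continuations of a ratio q at the previous coordinate sum to the window of v over
-- q < i / m < q + 1. A relation ≪ that is additive in both arguments and satisfies
-- u ≪ v → v ≪ z u is propagated by such windows: the property that v_i ≪ v_j for i ≤ j ≤ i + m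
-- passes from each coordinate to the previous one.
--
-- Two choices of ≪ give the theorem. Evaluating at w with Im w > 0, let u ≪ v say that u, v
-- and w u are met in counterclockwise order within a half turn; then a sum of related numbers
-- vanishes only if all of them do, so the polynomial has no zero off the real line unless there
-- are no points. On coefficient sequences, ≪ is a total positivity condition of order two,
-- whose diagonal case gives log-concavity without internal zeros.

{-# OPTIONS --safe #-}
module Submission where

open import Defs
open import Algebra.Bundles using (CommutativeMonoid; CommutativeRing)
import Algebra.Construct.Pointwise as Pointwise
import Algebra.Properties.CommutativeSemigroup as CommutativeSemigroupₚ
open import Data.Bool.Base using (Bool; true; false; if_then_else_; _∧_)
open import Data.Integer.Base as ℤ using (ℤ; +_)
import Data.Integer.Properties as ℤₚ
open import Data.List.Base as List using (List; []; _∷_)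
open import Data.List.Membership.Propositional using (_∈_)
open import Data.List.Membership.Propositional.Properties
  using (∈-map⁻; ∈-filter⁻; ∈-cartesianProductWith⁻)
open import Data.List.Relation.Unary.Any using (here)
open import Data.List.Relation.Unary.Linked using (_∷_; linked?)
open import Data.Nat.Base as ℕ using (ℕ; zero; suc; pred; NonZero)
open import Data.Nat.Divisibility using (divides-refl)
open import Data.Nat.DivMod using (_/_; m<n*o⇒m/o<n; m*n/n≡m; /-monoˡ-≤; +-distrib-/-∣ʳ)
import Data.Nat.Properties as ℕₚ
open import Data.Product.Base using (∃; _×_; _,_; proj₂)
open import Data.Rational.Base as ℚ using (ℚ; 0ℚ; 1ℚ; ½)
import Data.Rational.Properties as ℚₚ
open import Data.Rational.Solver using (module +-*-Solver)
open import Data.Rational.Unnormalised.Base as ℚᵘ using (mkℚᵘ; *≡*)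
import Data.Rational.Unnormalised.Properties as ℚᵘₚ
open import Data.Sum.Base as Sum using (_⊎_; inj₁; inj₂)
open import Data.Vec.Base as Vec using (Vec; []; _∷_; _∷ʳ_)
open import Function.Base using (_∘_)
open import Level using (0ℓ)
open import Relation.Binary.PropositionalEquality as ≡ using (_≡_; refl; cong; subst; subst₂)
open import Relation.Nullary.Decidable using (Dec; yes; no; does; _×-dec_)
open import Relation.Nullary.Negation using (¬_; contradiction)
import Relation.Binary.Reasoning.Setoid as SetoidReasoning

open Points using (Step; ratio; Steps; steps?; box)
open Estimates using (both; 0<½*; ½+½; scaled; bounded)
open Congruence using (pointwise; +-cong; *-cong; -‿cong)
open Geometry
  using (toℚᵘ-int; ∣p∣<⇒p<; shift-<; cancel-+-<; ≈⇒≤; ≤-trans; +-monoʳ-≤)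
open CommutativeRing ℝ-commutativeRing using (+-identityʳ)
  renaming (refl to ≈-refl; sym to ≈-sym; trans to ≈-trans)
open CommutativeSemigroupₚ ℕₚ.*-commutativeSemigroup using (xy∙z≈xz∙y)
open +-*-Solver using (solve; con; _:=_; _:+_; _:*_; _:-_; :-_)

private
  module ℝ-ring = CommutativeRing ℝ-commutativeRing

-- Consecutive ratios as an interval of numerators

module Ends (y : ℕ) .{{_ : NonZero y}} where

  -- `until N` is the ceiling of `N / y`. The multiples `i * y` strictly above `N` start at
  -- `i = first N`, and those strictly below `N` stop just before `i = until N`.
  first until : ℕ → ℕ
  first N = suc (N / y)
  until N = (N ℕ.+ pred y) / y

  first-≤ : ∀ {N i} → N ℕ.< i ℕ.* y → first N ℕ.≤ i
  first-≤ = m<n*o⇒m/o<n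

  first-≤⁻ : ∀ {N i} → first N ℕ.≤ i → N ℕ.< i ℕ.* y
  first-≤⁻ {N} {i} h = ℕₚ.≰⇒> λ iy≤N →
    ℕₚ.<⇒≱ h (subst (ℕ._≤ N / y) (m*n/n≡m i y) (/-monoˡ-≤ y iy≤N))

  private
    +pred : ∀ N → suc (N ℕ.+ pred y) ≡ y ℕ.+ N
    +pred N = ≡.trans (≡.sym (ℕₚ.+-suc N (pred y)))
      (≡.trans (cong (N ℕ.+_) (ℕₚ.suc-pred y)) (ℕₚ.+-comm N y))

  <-until : ∀ {N i} → i ℕ.* y ℕ.< N → i ℕ.< until N
  <-until {N} {i} h = subst (ℕ._≤ until N) (m*n/n≡m (suc i) y)
    (/-monoˡ-≤ y (ℕ.s≤s⁻¹ (subst (suc (y ℕ.+ i ℕ.* y) ℕ.≤_) (≡.sym (+pred N))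
      (subst (ℕ._≤ y ℕ.+ N) (ℕₚ.+-suc y _) (ℕₚ.+-monoʳ-≤ y h)))))

  <-until⁻ : ∀ {N i} → i ℕ.< until N → i ℕ.* y ℕ.< N
  <-until⁻ {N} {i} h = ℕₚ.≰⇒> λ N≤iy → ℕₚ.<⇒≱ h (ℕ.s≤s⁻¹ (m<n*o⇒m/o<n
    (subst (ℕ._≤ suc i ℕ.* y) (≡.sym (+pred N)) (ℕₚ.+-monoʳ-≤ y N≤iy))))

  -- The two ends differ by one exactly when `y` divides `N`, and agree otherwise. With
  -- `first-≤-until` this gives the closeness hypotheses of `segment-local`.
  until-≤-first : ∀ N → until N ℕ.≤ first N
  until-≤-first N = ℕₚ.≮⇒≥ λ h → ℕₚ.<-asym (<-until⁻ h) (first-≤⁻ ℕₚ.≤-refl)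

  first-≤-until : ∀ N → first N ℕ.≤ suc (until N)
  first-≤-until N = ℕ.s≤s (/-monoˡ-≤ y (ℕₚ.m≤m+n N (pred y)))

  first-mono : ∀ {M N} → M ℕ.≤ N → first M ℕ.≤ first N
  first-mono M≤N = ℕ.s≤s (/-monoˡ-≤ y M≤N)

  until-mono : ∀ {M N} → M ℕ.≤ N → until M ℕ.≤ until N
  until-mono M≤N = /-monoˡ-≤ y (ℕₚ.+-monoˡ-≤ (pred y) M≤N)

  private
    /-+* : ∀ N k → (N ℕ.+ k ℕ.* y) / y ≡ N / y ℕ.+ k
    /-+* N k = ≡.trans (+-distrib-/-∣ʳ N (divides-refl k)) (cong (N / y ℕ.+_) (m*n/n≡m k y))

  first-+ : ∀ N k → first (N ℕ.+ k ℕ.* y) ≡ first N ℕ.+ k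
  first-+ N k = cong suc (/-+* N k)

  until-+ : ∀ N k → until (N ℕ.+ k ℕ.* y) ≡ until N ℕ.+ k
  until-+ N k = ≡.trans (cong (_/ y) (≡.trans (ℕₚ.+-assoc N _ _)
      (≡.trans (cong (N ℕ.+_) (ℕₚ.+-comm (k ℕ.* y) _)) (≡.sym (ℕₚ.+-assoc N _ _)))))
    (/-+* (N ℕ.+ pred y) k)

*-advance : ∀ x y m → (x ℕ.+ y) ℕ.* m ≡ x ℕ.* m ℕ.+ m ℕ.* y
*-advance x y m = ≡.trans (ℕₚ.*-distribʳ-+ m x y) (cong (x ℕ.* m ℕ.+_) (ℕₚ.*-comm y m))

-- This is x / y < i / m < x / y + 1 with denominators cleared, so that division of naturals can cut
-- out the admissible `i`.
Between : ℕ → ℕ⁺ → ℕ → ℕ⁺ → Set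
Between x y i m = x ℕ.* value m ℕ.< i ℕ.* value y × i ℕ.* value y ℕ.< (x ℕ.+ value y) ℕ.* value m

module Between where

  toℚᵘ-ratio : ∀ x k → ℚ.toℚᵘ (ratio (+ x) (pos (suc k))) ℚᵘ.≃ mkℚᵘ (+ x) k
  toℚᵘ-ratio x k = ℚᵘₚ.≃-trans (ℚₚ.toℚᵘ-homo-* (+ x ℚ./ 1) (+ 1 ℚ./ suc k))
    (ℚᵘₚ.≃-trans (ℚᵘₚ.*-cong (ℚₚ.toℚᵘ-fromℚᵘ (mkℚᵘ (+ x) 0)) (ℚₚ.toℚᵘ-fromℚᵘ (mkℚᵘ (+ 1) k)))
      (*≡* (≡.cong₂ ℤ._*_ (ℤₚ.*-identityʳ (+ x)) (cong (λ j → + suc j) (≡.sym (ℕₚ.+-identityʳ k))))))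

  toℚᵘ-ratio+1 : ∀ x k → ℚ.toℚᵘ (ratio (+ x) (pos (suc k)) ℚ.+ 1ℚ) ℚᵘ.≃ mkℚᵘ (+ (x ℕ.+ suc k)) k
  toℚᵘ-ratio+1 x k = ℚᵘₚ.≃-trans (ℚₚ.toℚᵘ-homo-+ (ratio (+ x) (pos (suc k))) 1ℚ)
    (ℚᵘₚ.≃-trans (ℚᵘₚ.+-congˡ (ℚ.toℚᵘ 1ℚ) (toℚᵘ-ratio x k))
      (*≡* (≡.cong₂ ℤ._*_
        (≡.cong₂ ℤ._+_ (ℤₚ.*-identityʳ (+ x)) (ℤₚ.*-identityˡ (+ suc k)))
        (cong +_ (≡.sym (ℕₚ.*-identityʳ (suc k)))))))

  fromStep : ∀ x y i m → Step (ratio (+ x) y) (ratio (+ i) m) → Between x y i m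
  fromStep x (pos (suc k)) i (pos (suc l)) (p , q)
    with ℚᵘₚ.<-respˡ-≃ (toℚᵘ-ratio x k) (ℚᵘₚ.<-respʳ-≃ (toℚᵘ-ratio i l) (ℚₚ.toℚᵘ-mono-< p))
       | ℚᵘₚ.<-respˡ-≃ (toℚᵘ-ratio i l) (ℚᵘₚ.<-respʳ-≃ (toℚᵘ-ratio+1 x k) (ℚₚ.toℚᵘ-mono-< q))
  ... | ℚᵘ.*<* p′ | ℚᵘ.*<* q′ = drop-* x _ i _ p′ , drop-* i _ (x ℕ.+ suc k) _ q′
    where
    drop-* : ∀ a b c d → + a ℤ.* + b ℤ.< + c ℤ.* + d → a ℕ.* b ℕ.< c ℕ.* d
    drop-* a b c d h = ℤₚ.drop‿+<+ (≡.subst₂ ℤ._<_ (≡.sym (ℤₚ.pos-* a b)) (≡.sym (ℤₚ.pos-* c d)) h)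

  toStep : ∀ x y i m → Between x y i m → Step (ratio (+ x) y) (ratio (+ i) m)
  toStep x (pos (suc k)) i (pos (suc l)) (p , q) =
      ℚₚ.toℚᵘ-cancel-< (ℚᵘₚ.<-respˡ-≃ (ℚᵘₚ.≃-sym (toℚᵘ-ratio x k))
        (ℚᵘₚ.<-respʳ-≃ (ℚᵘₚ.≃-sym (toℚᵘ-ratio i l)) (ℚᵘ.*<* (lift-* x _ i _ p))))
    , ℚₚ.toℚᵘ-cancel-< (ℚᵘₚ.<-respˡ-≃ (ℚᵘₚ.≃-sym (toℚᵘ-ratio i l))
        (ℚᵘₚ.<-respʳ-≃ (ℚᵘₚ.≃-sym (toℚᵘ-ratio+1 x k)) (ℚᵘ.*<* (lift-* i _ (x ℕ.+ suc k) _ q))))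
    where
    lift-* : ∀ a b c d → a ℕ.* b ℕ.< c ℕ.* d → + a ℤ.* + b ℤ.< + c ℤ.* + d
    lift-* a b c d h = ≡.subst₂ ℤ._<_ (ℤₚ.pos-* a b) (ℤₚ.pos-* c d) (ℤ.+<+ h)

box-ℕ : ∀ {m} k (t : Vec ℕ⁺ m) {z} → z ∈ box k t → ∃ λ (z′ : Vec ℕ m) → z ≡ Vec.map +_ z′
box-ℕ k []      (here refl) = [] , refl
box-ℕ k (m ∷ t) z∈
  with ∈-cartesianProductWith⁻ _∷_ (List.map +_ (List.upTo (k ℕ.* value m))) (box (suc k) t) z∈
... | i , z , i∈ , z∈′ , refl with ∈-map⁻ +_ i∈ | box-ℕ (suc k) t z∈′
...   | j , _ , refl | z′ , refl = j ∷ z′ , refl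

-- Sums over windows of an interlacing family

-- `shift` stands for multiplication by z and `one` for the constant 1. The fields `∙-zero`,
-- `shift-zero` and `one≉ε` serve to show that the total over a nonempty set of points does not
-- vanish.
record InterlacingStructure : Set₁ where
  field
    commutativeMonoid : CommutativeMonoid 0ℓ 0ℓ
  open CommutativeMonoid commutativeMonoid public
    renaming (_≈_ to _≋_; refl to ≋-refl; sym to ≋-sym; trans to ≋-trans
             ; reflexive to ≋-reflexive)
  infix 4 _≪_
  field
    shift      : Carrier → Carrier
    shift-∙    : ∀ u v → shift (u ∙ v) ≋ shift u ∙ shift v
    shift-ε    : shift ε ≋ ε
    one        : Carrier
    _≪_        : Carrier → Carrier → Set
    ≪-resp     : ∀ {u u′ v v′} → u ≋ u′ → v ≋ v′ → u ≪ v → u′ ≪ v′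
    ε-≪        : ∀ v → ε ≪ v
    ≪-ε        : ∀ u → u ≪ ε
    ∙-≪        : ∀ {u u′ v} → u ≪ v → u′ ≪ v → u ∙ u′ ≪ v
    ≪-∙        : ∀ {u v v′} → u ≪ v → u ≪ v′ → u ≪ v ∙ v′
    -- Not a consequence of additivity, as v ≪ u need not hold.
    ∙-≪-∙      : ∀ {u v} → u ≪ u → v ≪ v → u ≪ v → u ∙ v ≪ u ∙ v
    rotate     : ∀ {u v} → u ≪ v → v ≪ shift u
    one-≪      : one ≪ one
    ∙-zero     : ∀ {u v} → u ≪ v → u ∙ v ≋ ε → u ≋ ε × v ≋ ε
    shift-zero : ∀ {u} → shift u ≋ ε → u ≋ ε
    one≉ε      : ¬ one ≋ ε

module Windows (I : InterlacingStructure) where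

  open InterlacingStructure I
  open SetoidReasoning setoid

  power : ℕ → Carrier
  power zero    = one
  power (suc i) = shift (power i)

  run : (ℕ → Carrier) → ℕ → ℕ → Carrier
  run v b zero    = ε
  run v b (suc l) = v b ∙ run v (suc b) l

  run-++ : ∀ v b l l′ → run v b (l ℕ.+ l′) ≋ run v b l ∙ run v (b ℕ.+ l) l′
  run-++ v b zero    l′ = ≋-trans (≋-reflexive (cong (λ c → run v c l′) (≡.sym (ℕₚ.+-identityʳ b))))
                                  (≋-sym (identityˡ _))
  run-++ v b (suc l) l′ = begin
    v b ∙ run v (suc b) (l ℕ.+ l′)
      ≈⟨ ∙-congˡ (run-++ v (suc b) l l′) ⟩
    v b ∙ (run v (suc b) l ∙ run v (suc b ℕ.+ l) l′)
      ≡⟨ cong (λ c → v b ∙ (run v (suc b) l ∙ run v c l′)) (≡.sym (ℕₚ.+-suc b l)) ⟩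
    v b ∙ (run v (suc b) l ∙ run v (b ℕ.+ suc l) l′)
      ≈⟨ assoc _ _ _ ⟨
    (v b ∙ run v (suc b) l) ∙ run v (b ℕ.+ suc l) l′
      ∎

  widen : ∀ b l {i} → i ℕ.< suc b ℕ.+ l → i ℕ.< b ℕ.+ suc l
  widen b l {i} = subst (i ℕ.<_) (≡.sym (ℕₚ.+-suc b l))

  run-cong : ∀ {u v} b l → (∀ {i} → b ℕ.≤ i → i ℕ.< b ℕ.+ l → u i ≋ v i) → run u b l ≋ run v b l
  run-cong b zero    e = ≋-refl
  run-cong b (suc l) e = ∙-cong (e ℕₚ.≤-refl (ℕₚ.m<m+n b ℕₚ.0<1+n))
    (run-cong (suc b) l λ h k → e (ℕₚ.<⇒≤ h) (widen b l k))

  run-ε : ∀ b l → run (λ _ → ε) b l ≋ ε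
  run-ε b zero    = ≋-refl
  run-ε b (suc l) = ≋-trans (identityˡ _) (run-ε (suc b) l)

  run-shift : ∀ {v m} → (∀ i → v (i ℕ.+ m) ≋ shift (v i)) →
              ∀ b l → run v (b ℕ.+ m) l ≋ shift (run v b l)
  run-shift p b zero    = ≋-sym shift-ε
  run-shift p b (suc l) = ≋-trans (∙-cong (p b) (run-shift p (suc b) l)) (≋-sym (shift-∙ _ _))

  run-≪ʳ : ∀ {u v} c k → (∀ {j} → c ℕ.≤ j → j ℕ.< c ℕ.+ k → u ≪ v j) → u ≪ run v c k
  run-≪ʳ c zero    h = ≪-ε _
  run-≪ʳ c (suc k) h = ≪-∙ (h ℕₚ.≤-refl (ℕₚ.m<m+n c ℕₚ.0<1+n))
    (run-≪ʳ (suc c) k λ p q → h (ℕₚ.<⇒≤ p) (widen c k q))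

  run-≪ˡ : ∀ {u v} b l → (∀ {i} → b ℕ.≤ i → i ℕ.< b ℕ.+ l → v i ≪ u) → run v b l ≪ u
  run-≪ˡ b zero    h = ε-≪ _
  run-≪ˡ b (suc l) h = ∙-≪ (h ℕₚ.≤-refl (ℕₚ.m<m+n b ℕₚ.0<1+n))
    (run-≪ˡ (suc b) l λ p q → h (ℕₚ.<⇒≤ p) (widen b l q))

  -- All pairs are compared and not just neighbours, because `≪` need not be transitive: every `u`
  -- and `v` satisfy `u ≪ ε` and `ε ≪ v`.
  Ascending : (ℕ → Carrier) → ℕ → ℕ → Set
  Ascending v b e = ∀ {i j} → b ℕ.≤ i → i ℕ.≤ j → j ℕ.< e → v i ≪ v j

  -- Peels off the first term for induction on the length: `run-≪` passes the results to `∙-≪-∙`,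
  -- and `run-zero` passes them to `∙-zero`.
  run-ascending : ∀ {v} b l → Ascending v b (b ℕ.+ suc l) →
    v b ≪ v b × v b ≪ run v (suc b) l × Ascending v (suc b) (suc b ℕ.+ l)
  run-ascending {v} b l asc =
      asc ℕₚ.≤-refl ℕₚ.≤-refl (ℕₚ.m<m+n b ℕₚ.0<1+n)
    , run-≪ʳ (suc b) l (λ p q → asc ℕₚ.≤-refl (ℕₚ.<⇒≤ p) (widen b l q))
    , λ p q r → asc (ℕₚ.<⇒≤ p) q (widen b l r)

  run-≪ : ∀ {v} b l → Ascending v b (b ℕ.+ l) → run v b l ≪ run v b l
  run-≪ b zero    asc = ≪-ε _
  run-≪ b (suc l) asc with run-ascending b l asc
  ... | b≪b , b≪ , asc′ = ∙-≪-∙ b≪b (run-≪ (suc b) l asc′) b≪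

  run-zero : ∀ {v} b l → Ascending v b (b ℕ.+ l) → run v b l ≋ ε →
             ∀ {i} → b ℕ.≤ i → i ℕ.< b ℕ.+ l → v i ≋ ε
  run-zero b zero    asc e b≤i i< = contradiction b≤i (ℕₚ.<⇒≱ (subst (_ ℕ.<_) (ℕₚ.+-identityʳ b) i<))
  run-zero b (suc l) asc e {i} b≤i i< with run-ascending b l asc
  ... | b≪b , b≪ , asc′ with ∙-zero b≪ e | b ℕₚ.≟ i
  ...   | e₁ , e₂ | yes refl = e₁
  ...   | e₁ , e₂ | no b≢i   = run-zero (suc b) l asc′ e₂ (ℕₚ.≤∧≢⇒< b≤i b≢i)
                                 (subst (i ℕ.<_) (ℕₚ.+-suc b l) i<)

  segment : (ℕ → Carrier) → ℕ → ℕ → Carrier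
  segment v b e = run v b (e ℕ.∸ b)

  module _ {v : ℕ → Carrier} where

    segment-++ : ∀ {b c e} → b ℕ.≤ c → c ℕ.≤ e → segment v b e ≋ segment v b c ∙ segment v c e
    segment-++ {b} {c} {e} b≤c c≤e = begin
      run v b (e ℕ.∸ b)
        ≡⟨ cong (run v b) (≡.trans (cong (ℕ._∸ b) (≡.sym (ℕₚ.m+[n∸m]≡n c≤e)))
             (ℕₚ.+-∸-comm (e ℕ.∸ c) b≤c)) ⟩
      run v b (c ℕ.∸ b ℕ.+ (e ℕ.∸ c))
        ≈⟨ run-++ v b (c ℕ.∸ b) (e ℕ.∸ c) ⟩
      run v b (c ℕ.∸ b) ∙ run v (b ℕ.+ (c ℕ.∸ b)) (e ℕ.∸ c)
        ≡⟨ cong (λ d → run v b (c ℕ.∸ b) ∙ run v d (e ℕ.∸ c)) (ℕₚ.m+[n∸m]≡n b≤c) ⟩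
      run v b (c ℕ.∸ b) ∙ run v c (e ℕ.∸ c)
        ∎

    segment-shift : ∀ {m} → (∀ i → v (i ℕ.+ m) ≋ shift (v i)) →
                    ∀ b e → segment v (b ℕ.+ m) (e ℕ.+ m) ≋ shift (segment v b e)
    segment-shift {m} p b e = ≋-trans
      (≋-reflexive (cong (run v (b ℕ.+ m))
        (≡.trans (≡.cong₂ ℕ._∸_ (ℕₚ.+-comm e m) (ℕₚ.+-comm b m)) (ℕₚ.[m+n]∸[m+o]≡n∸o m e b))))
      (run-shift p b (e ℕ.∸ b))

    inside : ∀ {b e i} → b ℕ.≤ i → i ℕ.< b ℕ.+ (e ℕ.∸ b) → i ℕ.< e
    inside {b} {e} b≤i i< with ℕₚ.≤-total b e
    ... | inj₁ b≤e = subst (_ ℕ.<_) (ℕₚ.m+[n∸m]≡n b≤e) i<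
    ... | inj₂ e≤b = contradiction b≤i (ℕₚ.<⇒≱ (subst (_ ℕ.<_)
                       (≡.trans (cong (b ℕ.+_) (ℕₚ.m≤n⇒m∸n≡0 e≤b)) (ℕₚ.+-identityʳ b)) i<))

    segment-≪-segment : ∀ b {e} c {f} →
      (∀ {i j} → b ℕ.≤ i → i ℕ.< e → c ℕ.≤ j → j ℕ.< f → v i ≪ v j) →
      segment v b e ≪ segment v c f
    segment-≪-segment b c h = run-≪ˡ b _ λ p q → run-≪ʳ c _ λ r s → h p (inside p q) r (inside r s)

    segment-≪ : ∀ {b e} → Ascending v b e → segment v b e ≪ segment v b e
    segment-≪ {b} asc = run-≪ b _ λ p q r → asc p q (inside (ℕₚ.≤-trans p q) r)

    segment-zero : ∀ {b e} → Ascending v b e → segment v b e ≋ ε →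
                   ∀ {i} → b ℕ.≤ i → i ℕ.< e → v i ≋ ε
    segment-zero {b} {e} asc z {i} p q = run-zero b _
      (λ p q r → asc p q (inside (ℕₚ.≤-trans p q) r)) z p
      (subst (i ℕ.<_) (≡.sym (ℕₚ.m+[n∸m]≡n (ℕₚ.<⇒≤ (ℕₚ.≤-<-trans p q)))) q)

  record Admissible (v : ℕ → Carrier) (m : ℕ) : Set where
    field
      periodic : ∀ i → v (i ℕ.+ m) ≋ shift (v i)
      local    : ∀ {i j} → i ℕ.≤ j → j ℕ.≤ i ℕ.+ m → v i ≪ v j

    reach : ∀ {c i j} → c ℕ.≤ i → j ℕ.≤ c ℕ.+ m → j ℕ.≤ i ℕ.+ m
    reach c≤i j≤ = ℕₚ.≤-trans j≤ (ℕₚ.+-monoˡ-≤ m c≤i)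

    ascending : ∀ {b e} → e ℕ.≤ b ℕ.+ m → Ascending v b e
    ascending e≤ b≤i i≤j j<e = local i≤j (reach b≤i (ℕₚ.≤-trans (ℕₚ.<⇒≤ j<e) e≤))

    -- Here `a`, `b` are the values of `until` and `first` for one window, and `a′`, `b′` those for
    -- a later one. Since each pair is at most one apart, the windows either coincide, or differ by
    -- a full period, or satisfy `b ≤ a′` and `b′ ≤ a + m`; in the last case three consecutive
    -- pieces suffice.
    segment-local : ∀ {a b a′ b′} →
      a ℕ.≤ b → b ℕ.≤ suc a → a′ ℕ.≤ b′ → b′ ℕ.≤ suc a′ →
      a ℕ.≤ a′ → a′ ℕ.≤ a ℕ.+ m → b ℕ.≤ b′ → b′ ℕ.≤ b ℕ.+ m →
      segment v b (a ℕ.+ m) ≪ segment v b′ (a′ ℕ.+ m)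
    segment-local {a} {b} {a′} {b′} a≤b b≤1+a a′≤b′ b′≤1+a′ a≤a′ a′≤a+m b≤b′ b′≤b+m
      with b ℕₚ.≤? a′ | b′ ℕₚ.≤? a ℕ.+ m
    -- Here a′ < b ≤ a + 1 forces `a ≡ a′` and then `b ≡ b′`, so the claim is that one window is
    -- related to itself.
    ... | no b≰a′ | _ = ≡.subst₂ (λ c d → segment v b (a ℕ.+ m) ≪ segment v c (d ℕ.+ m))
            b≡b′ a≡a′ (segment-≪ (ascending (ℕₚ.+-monoˡ-≤ m a≤b)))
      where
      a≡a′ = ℕₚ.≤-antisym a≤a′ (ℕ.s≤s⁻¹ (ℕₚ.≤-trans (ℕₚ.≰⇒> b≰a′) b≤1+a))
      b≡b′ = ℕₚ.≤-antisym b≤b′ (ℕₚ.≤-trans b′≤1+a′ (ℕₚ.≰⇒> b≰a′))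
    -- Here a + m < b′ ≤ a′ + 1 forces the second window to be the first moved by `m`, so `rotate`
    -- applies to the relation of the first to itself.
    ... | yes _ | no b′≰a+m = ≪-resp ≋-refl
            (≋-trans (≋-sym (segment-shift periodic b (a ℕ.+ m)))
              (≋-reflexive (≡.cong₂ (λ c d → segment v c (d ℕ.+ m)) b+m≡b′ a+m≡a′)))
            (rotate (segment-≪ (ascending (ℕₚ.+-monoˡ-≤ m a≤b))))
      where
      a+m≡a′ = ℕₚ.≤-antisym (ℕ.s≤s⁻¹ (ℕₚ.≤-trans (ℕₚ.≰⇒> b′≰a+m) b′≤1+a′)) a′≤a+m
      b+m≡b′ = ℕₚ.≤-antisym (ℕₚ.≤-trans (ℕₚ.+-monoˡ-≤ m b≤1+a) (ℕₚ.≰⇒> b′≰a+m)) b′≤b+m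
    ... | yes b≤a′ | yes b′≤a+m = ≪-resp
            (≋-sym (segment-++ b≤b′ b′≤a+m)) (≋-sym (segment-++ b′≤a+m a+m≤a′+m))
            (∙-≪ (≪-∙ X≪Y X≪Z) (≪-∙ Y≪Y Y≪Z))
      where
      -- The windows are X ∙ Y and Y ∙ Z for X = [b, b′), Y = [b′, a + m) and Z = [a + m, a′ + m).
      a+m≤b+m  = ℕₚ.+-monoˡ-≤ m a≤b
      a+m≤a′+m = ℕₚ.+-monoˡ-≤ m a≤a′
      b+m≤a′+m = ℕₚ.+-monoˡ-≤ m b≤a′
      a′+m≤b′+m = ℕₚ.+-monoˡ-≤ m a′≤b′
      segment-apart : ∀ {c d e f} → d ℕ.≤ e → f ℕ.≤ c ℕ.+ m → segment v c d ≪ segment v e f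
      segment-apart {c} {d} {e} d≤e f≤c+m = segment-≪-segment c e λ c≤i i<d e≤j j<f →
        local (ℕₚ.<⇒≤ (ℕₚ.<-≤-trans i<d (ℕₚ.≤-trans d≤e e≤j)))
              (reach c≤i (ℕₚ.≤-trans (ℕₚ.<⇒≤ j<f) f≤c+m))
      X≪Y = segment-apart {b} {b′} {b′} {a ℕ.+ m} ℕₚ.≤-refl a+m≤b+m
      Y≪Y = segment-≪ {b = b′} {a ℕ.+ m} (ascending (ℕₚ.≤-trans a+m≤b+m (ℕₚ.+-monoˡ-≤ m b≤b′)))
      Y≪Z = segment-apart {b′} {a ℕ.+ m} {a ℕ.+ m} {a′ ℕ.+ m} ℕₚ.≤-refl a′+m≤b′+m
      -- The part of Z beyond b + m is a rotated copy of the part of X below a′.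
      X≪Z = ≪-resp ≋-refl (≋-sym (segment-++ a+m≤b+m b+m≤a′+m))
        (≪-∙ (segment-apart {b} {b′} {a ℕ.+ m} {b ℕ.+ m} b′≤a+m ℕₚ.≤-refl)
             (≪-resp (≋-sym (segment-++ b≤a′ a′≤b′)) ≋-refl
               (∙-≪ (≪-resp ≋-refl (≋-sym (segment-shift periodic b a′))
                      (rotate (segment-≪ (ascending (ℕₚ.≤-trans a′≤b′ (ℕₚ.≤-trans b′≤a+m a+m≤b+m))))))
                    (segment-apart {a′} {b′} {b ℕ.+ m} {a′ ℕ.+ m}
                      (ℕₚ.≤-trans b′≤a+m a+m≤b+m) ℕₚ.≤-refl))))

  -- The segment runs over the `i` with `Between x y i m`. Its upper end is `until ((x + y) * m)`,
  -- rewritten so that both ends are taken at the same numerator `x * m`, as `segment-local`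
  -- expects.
  window : (ℕ → Carrier) → ℕ⁺ → ℕ⁺ → ℕ → Carrier
  window v m (pos y) x = segment v (first (x ℕ.* value m)) (until (x ℕ.* value m) ℕ.+ value m)
    where open Ends y

  -- Replacing `x` by `x + y` moves both ends of the window by `m`, one period of `v`; this turns
  -- period `m` into period `y`. For x ≤ x′ ≤ x + y the ends are monotone and move by at most `m`,
  -- so `segment-local` applies.
  window-admissible : ∀ {v m} → Admissible v (value m) → ∀ y → Admissible (window v m y) (value y)
  window-admissible {v} {m⁺} adm (pos y) = record
    { periodic = λ x → ≋-trans
        (≋-reflexive (≡.cong₂ (λ c d → segment v c (d ℕ.+ m)) (eq first first-+ x) (eq until until-+ x)))
        (segment-shift periodic (first (x ℕ.* m)) (until (x ℕ.* m) ℕ.+ m))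
    ; local = λ {x} {x′} x≤x′ x′≤x+y →
        let N≤N′  = ℕₚ.*-monoˡ-≤ m x≤x′
            N′≤N+ = ℕₚ.*-monoˡ-≤ m x′≤x+y
        in segment-local
          (until-≤-first (x ℕ.* m)) (first-≤-until (x ℕ.* m))
          (until-≤-first (x′ ℕ.* m)) (first-≤-until (x′ ℕ.* m))
          (until-mono N≤N′) (subst (until (x′ ℕ.* m) ℕ.≤_) (eq until until-+ x) (until-mono N′≤N+))
          (first-mono N≤N′) (subst (first (x′ ℕ.* m) ℕ.≤_) (eq first first-+ x) (first-mono N′≤N+))
    }
    where
    m = value m⁺
    open Ends y
    open Admissible adm
    eq : ∀ (f : ℕ → ℕ) → (∀ N k → f (N ℕ.+ k ℕ.* y) ≡ f N ℕ.+ k) →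
         ∀ x → f ((x ℕ.+ y) ℕ.* m) ≡ f (x ℕ.* m) ℕ.+ m
    eq f f-+ x = ≡.trans (cong f (*-advance x y m)) (f-+ (x ℕ.* m) m)

  module _ (x i : ℕ) (m : ℕ⁺) where

    between⇒window : ∀ y .{{_ : NonZero y}} → Between x (pos y) i m → let open Ends y in
      first (x ℕ.* value m) ℕ.≤ i × i ℕ.< until (x ℕ.* value m) ℕ.+ value m
    between⇒window y (p , q) = first-≤ {x ℕ.* value m} p ,
      subst (i ℕ.<_) (≡.trans (cong until (*-advance x y (value m))) (until-+ (x ℕ.* value m) (value m)))
        (<-until {(x ℕ.+ y) ℕ.* value m} q)
      where
      open Ends y

    window⇒between : ∀ y .{{_ : NonZero y}} → let open Ends y in
      first (x ℕ.* value m) ℕ.≤ i → i ℕ.< until (x ℕ.* value m) ℕ.+ value m → Between x (pos y) i m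
    window⇒between y p q = first-≤⁻ {x ℕ.* value m} p ,
      <-until⁻ {(x ℕ.+ y) ℕ.* value m} (subst (i ℕ.<_) (≡.sym (≡.trans (cong until (*-advance x y (value m))) (until-+ (x ℕ.* value m) (value m)))) q)
      where
      open Ends y

  window-zero : ∀ {v m} → Admissible v (value m) → ∀ y x → window v m y x ≋ ε →
                ∀ i → Between x y i m → v i ≋ ε
  window-zero {m = m} adm (pos y) x z i b with between⇒window x i m y b
  ... | p , q = segment-zero (Admissible.ascending adm (ℕₚ.+-monoˡ-≤ (value m) (Ends.until-≤-first y _))) z p q

  -- The total over the continuations of the ratio x / y; compare total-points.
  weight : ∀ {n} → Vec ℕ⁺ n → ℕ⁺ → ℕ → Carrier
  weight []      = window power 1⁺
  weight (m ∷ s) = window (weight s m) m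

  power-admissible : Admissible power 1
  power-admissible = record
    { periodic = λ i → ≋-reflexive (cong power (ℕₚ.+-comm i 1))
    ; local    = λ {i} {j} i≤j j≤i+1 → local i j i≤j (subst (j ℕ.≤_) (ℕₚ.+-comm i 1) j≤i+1)
    }
    where
    power-≪ : ∀ i → power i ≪ power i
    power-≪ zero    = one-≪
    -- The first `rotate` turns u ≪ u into u ≪ z u, the second into z u ≪ z u.
    power-≪ (suc i) = rotate (rotate (power-≪ i))
    local : ∀ i j → i ℕ.≤ j → j ℕ.≤ suc i → power i ≪ power j
    local i j i≤j j≤1+i with ℕₚ.m≤n⇒m<n∨m≡n i≤j
    ... | inj₁ i<j  = subst (λ j → power i ≪ power j) (ℕₚ.≤-antisym i<j j≤1+i) (rotate (power-≪ i))
    ... | inj₂ refl = power-≪ i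

  weight-admissible : ∀ {n} (s : Vec ℕ⁺ n) y → Admissible (weight s y) (value y)
  weight-admissible []      = window-admissible {m = 1⁺} power-admissible
  weight-admissible (m ∷ s) = window-admissible {m = m} (weight-admissible s m)

  power≉ε : ∀ i → ¬ power i ≋ ε
  power≉ε zero    e = one≉ε e
  power≉ε (suc i) e = power≉ε i (shift-zero e)

  -- A single point suffices: a vanishing window has only vanishing terms, so following the
  -- coordinates of `z` would make a power of z vanish.
  weight≉ε : ∀ {n} (s : Vec ℕ⁺ n) y x (z : Vec ℕ (suc n)) →
    Steps (ratio (+ x) y) (Vec.map +_ z) (s ∷ʳ 1⁺) → ¬ weight s y x ≋ ε
  weight≉ε []      y x (i ∷ []) (p ∷ _)  e =
    power≉ε i (window-zero {m = 1⁺} power-admissible y x e i (Between.fromStep x y i 1⁺ p))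
  weight≉ε (m ∷ s) y x (i ∷ z)  (p ∷ ps) e = weight≉ε s m i z ps
    (window-zero {m = m} (weight-admissible s m) y x e i (Between.fromStep x y i m p))

  -- Totals over the enumerated lattice points

  total : {A : Set} → (A → Carrier) → List A → Carrier
  total f = List.foldr (λ a u → f a ∙ u) ε

  total-cong : ∀ {A : Set} {f g : A → Carrier} → (∀ a → f a ≋ g a) → ∀ as → total f as ≋ total g as
  total-cong e []       = ≋-refl
  total-cong e (a ∷ as) = ∙-cong (e a) (total-cong e as)

  total-ε : ∀ {A : Set} (as : List A) → total (λ _ → ε) as ≋ ε
  total-ε []       = ≋-refl
  total-ε (a ∷ as) = ≋-trans (identityˡ _) (total-ε as)

  total-++ : ∀ {A : Set} (f : A → Carrier) as bs → total f (as List.++ bs) ≋ total f as ∙ total f bs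
  total-++ f []       bs = ≋-sym (identityˡ _)
  total-++ f (a ∷ as) bs = ≋-trans (∙-congˡ (total-++ f as bs)) (≋-sym (assoc _ _ _))

  total-map : ∀ {A B : Set} (f : B → Carrier) (g : A → B) as → total f (List.map g as) ≋ total (f ∘ g) as
  total-map f g []       = ≋-refl
  total-map f g (a ∷ as) = ∙-congˡ (total-map f g as)

  total-cartesianProductWith : ∀ {A B C : Set} (f : C → Carrier) (g : A → B → C) as bs →
    total f (List.cartesianProductWith g as bs) ≋ total (λ a → total (f ∘ g a) bs) as
  total-cartesianProductWith f g []       bs = ≋-refl
  total-cartesianProductWith f g (a ∷ as) bs = ≋-trans (total-++ f (List.map (g a) bs) _)
    (∙-cong (total-map f (g a) bs) (total-cartesianProductWith f g as bs))

  when : Bool → Carrier → Carrier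
  when b u = if b then u else ε

  when-yes : ∀ {P : Set} (P? : Dec P) {u} → P → when (does P?) u ≋ u
  when-yes (yes _) p = ≋-refl
  when-yes (no ¬p) p = contradiction p ¬p

  when-no : ∀ {P : Set} (P? : Dec P) {u} → ¬ P → when (does P?) u ≋ ε
  when-no (yes p) ¬p = contradiction p ¬p
  when-no (no _)  ¬p = ≋-refl

  when-cong : ∀ {P : Set} (P? : Dec P) {u v} → (P → u ≋ v) → when (does P?) u ≋ when (does P?) v
  when-cong (yes p) e = e p
  when-cong (no _)  e = ≋-refl

  when-∧ : ∀ a b {u} → when (a ∧ b) u ≋ when a (when b u)
  when-∧ true  b = ≋-refl
  when-∧ false b = ≋-refl

  total-when : ∀ {A : Set} a f (as : List A) → total (λ x → when a (f x)) as ≋ when a (total f as)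
  total-when true  f as = ≋-refl
  total-when false f as = total-ε as

  total-filter : ∀ {A : Set} {P : A → Set} (P? : ∀ a → Dec (P a)) f as →
    total f (List.filter P? as) ≋ total (λ a → when (does (P? a)) (f a)) as
  total-filter P? f []       = ≋-refl
  total-filter P? f (a ∷ as) with does (P? a)
  ... | true  = ∙-congˡ (total-filter P? f as)
  ... | false = ≋-trans (total-filter P? f as) (≋-sym (identityˡ _))

  total-applyUpTo : ∀ {A : Set} (f : A → Carrier) g k → ∀ b (v : ℕ → Carrier) →
    (∀ i → f (g i) ≋ v (b ℕ.+ i)) → total f (List.applyUpTo g k) ≋ run v b k
  total-applyUpTo f g zero    b v e = ≋-refl
  total-applyUpTo f g (suc k) b v e = ∙-cong
    (≋-trans (e 0) (≋-reflexive (cong v (ℕₚ.+-identityʳ b))))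
    (total-applyUpTo f (g ∘ suc) k (suc b) v λ i →
      ≋-trans (e (suc i)) (≋-reflexive (cong v (ℕₚ.+-suc b i))))

  segment-restrict : ∀ {u v b e k} → b ℕ.≤ e → e ℕ.≤ k →
    (∀ {i} → i ℕ.< b → u i ≋ ε) → (∀ {i} → b ℕ.≤ i → i ℕ.< e → u i ≋ v i) →
    (∀ {i} → e ℕ.≤ i → u i ≋ ε) → run u 0 k ≋ segment v b e
  segment-restrict {u} {v} {b} {e} {k} b≤e e≤k below within above = begin
    segment u 0 k
      ≈⟨ segment-++ {u} {0} {b} {k} ℕ.z≤n (ℕₚ.≤-trans b≤e e≤k) ⟩
    run u 0 b ∙ segment u b k
      ≈⟨ ∙-cong (≋-trans (run-cong 0 b λ _ → below) (run-ε 0 b)) (segment-++ {u} b≤e e≤k) ⟩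
    ε ∙ (segment u b e ∙ segment u e k)
      ≈⟨ identityˡ _ ⟩
    segment u b e ∙ segment u e k
      ≈⟨ ∙-cong (run-cong b (e ℕ.∸ b) λ p q → within p (inside {u} p q))
           (≋-trans (run-cong e (k ℕ.∸ e) λ p _ → above p) (run-ε e (k ℕ.∸ e))) ⟩
    segment v b e ∙ ε
      ≈⟨ identityʳ _ ⟩
    segment v b e
      ∎

  step? : ∀ p q → Dec (Step p q)
  step? p q = (p ℚₚ.<? q) ×-dec (q ℚₚ.<? p ℚ.+ 1ℚ)

  -- The hypothesis says x / y + 1 ≤ k, so every `i` in the window lies below the search bound
  -- `k * m`. Outside the window the step test contributes `ε`.
  total-window : ∀ v m y x k → x ℕ.+ value y ℕ.≤ k ℕ.* value y →
    total (λ i → when (does (step? (ratio (+ x) y) (ratio (+ i) m))) (v i)) (List.upTo (k ℕ.* value m)) ≋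
    window v m y x
  total-window v m⁺@(pos m) y⁺@(pos y) x k x+y≤ky = ≋-trans
    (total-applyUpTo _ (λ i → i) (k ℕ.* m) 0 u λ _ → ≋-refl)
    (segment-restrict b≤e e≤K
      (λ {i} i<b → outside i λ (b≤i , _) → ℕₚ.<⇒≱ i<b b≤i)
      (λ {i} b≤i i<e → cover i b≤i i<e)
      (λ {i} e≤i → outside i λ (_ , i<e) → ℕₚ.<⇒≱ i<e e≤i))
    where
    open Ends y
    N = x ℕ.* m
    u : ℕ → Carrier
    u i = when (does (step? (ratio (+ x) y⁺) (ratio (+ i) m⁺))) (v i)
    b≤e : first N ℕ.≤ until N ℕ.+ m
    b≤e = ℕₚ.≤-trans (first-≤-until N) (subst (ℕ._≤ until N ℕ.+ m) (ℕₚ.+-comm _ 1)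
      (ℕₚ.+-monoʳ-≤ (until N) (ℕ.>-nonZero⁻¹ m)))
    e≤K : until N ℕ.+ m ℕ.≤ k ℕ.* m
    e≤K = ℕₚ.≮⇒≥ λ K<e → ℕₚ.<⇒≱
      (<-until⁻ {(x ℕ.+ y) ℕ.* m} {k ℕ.* m} (subst (k ℕ.* m ℕ.<_) (≡.sym (≡.trans (cong until
        (*-advance x y m)) (until-+ N m))) K<e))
      (subst ((x ℕ.+ y) ℕ.* m ℕ.≤_)
        (xy∙z≈xz∙y k y m)
        (ℕₚ.*-monoˡ-≤ m x+y≤ky))
    outside : ∀ i → ¬ (first N ℕ.≤ i × i ℕ.< until N ℕ.+ m) → u i ≋ ε
    outside i ¬w = when-no (step? (ratio (+ x) y⁺) (ratio (+ i) m⁺)) λ st →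
      ¬w (between⇒window x i m⁺ y (Between.fromStep x y⁺ i m⁺ st))
    cover : ∀ i → first N ℕ.≤ i → i ℕ.< until N ℕ.+ m → u i ≋ v i
    cover i p q = when-yes (step? (ratio (+ x) y⁺) (ratio (+ i) m⁺))
      (Between.toStep x y⁺ i m⁺ (window⇒between x i m⁺ y p q))

  when-linked : ∀ {A : Set} {R : A → A → Set} (R? : ∀ a b → Dec (R a b)) a b as {u} →
    when (does (linked? R? (a ∷ b ∷ as))) u ≋ when (does (R? a b)) (when (does (linked? R? (b ∷ as))) u)
  when-linked R? a b as = when-∧ (does (R? a b)) (does (linked? R? (b ∷ as)))

  -- The test for the whole chain is the first step together with the test for the rest, so the
  -- total splits along the first coordinate. The assumption on the rest is required only for
  -- `i ≤ k * m`, which a successful first step guarantees.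
  total-step : ∀ {n} f v m y x k (t : Vec ℕ⁺ n) → x ℕ.+ value y ℕ.≤ k ℕ.* value y →
    (∀ i → i ℕ.≤ k ℕ.* value m →
      total (λ z → f (+ i ∷ z)) (List.filter (steps? (ratio (+ i) m) t) (box (suc k) t)) ≋ v i) →
    total f (List.filter (steps? (ratio (+ x) y) (m ∷ t)) (box k (m ∷ t))) ≋ window v m y x
  total-step f v m y x k t x+y≤ky e = begin
    total f (List.filter (steps? q (m ∷ t)) (box k (m ∷ t)))
      ≈⟨ total-filter (steps? q (m ∷ t)) f (box k (m ∷ t)) ⟩
    total g (box k (m ∷ t))
      ≈⟨ total-cartesianProductWith g _∷_ (List.map +_ (List.upTo (k ℕ.* value m))) (box (suc k) t) ⟩
    total (λ i → total (g ∘ (i ∷_)) (box (suc k) t)) (List.map +_ (List.upTo (k ℕ.* value m)))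
      ≈⟨ total-map _ +_ (List.upTo (k ℕ.* value m)) ⟩
    total (λ i → total (g ∘ (+ i ∷_)) (box (suc k) t)) (List.upTo (k ℕ.* value m))
      ≈⟨ total-cong slice (List.upTo (k ℕ.* value m)) ⟩
    total (λ i → when (does (step? q (ratio (+ i) m))) (v i)) (List.upTo (k ℕ.* value m))
      ≈⟨ total-window v m y x k x+y≤ky ⟩
    window v m y x
      ∎
    where
    q = ratio (+ x) y
    g : Vec ℤ _ → Carrier
    g z = when (does (steps? q (m ∷ t) z)) (f z)
    slice : ∀ i → total (g ∘ (+ i ∷_)) (box (suc k) t) ≋ when (does (step? q (ratio (+ i) m))) (v i)
    slice i = begin
      total (g ∘ (+ i ∷_)) (box (suc k) t)
        ≈⟨ total-cong (λ z → when-linked step? q p (Vec.toList (Vec.zipWith ratio z t))) (box (suc k) t) ⟩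
      total (λ z → when (does (step? q p)) (when (does (steps? p t z)) (f (+ i ∷ z)))) (box (suc k) t)
        ≈⟨ total-when (does (step? q p)) _ (box (suc k) t) ⟩
      when (does (step? q p)) (total (λ z → when (does (steps? p t z)) (f (+ i ∷ z))) (box (suc k) t))
        ≈⟨ when-cong (step? q p) (λ st → ≋-trans
             (≋-sym (total-filter (steps? p t) (λ z → f (+ i ∷ z)) (box (suc k) t)))
             (e i (bound (proj₂ (Between.fromStep x y i m st))))) ⟩
      when (does (step? q p)) (v i)
        ∎
      where
      p = ratio (+ i) m
      bound : i ℕ.* value y ℕ.< (x ℕ.+ value y) ℕ.* value m → i ℕ.≤ k ℕ.* value m
      bound h = ℕₚ.<⇒≤ (ℕₚ.*-cancelʳ-< (value y) i (k ℕ.* value m) (ℕₚ.<-≤-trans h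
        (subst ((x ℕ.+ value y) ℕ.* value m ℕ.≤_)
          (xy∙z≈xz∙y k (value y) (value m))
          (ℕₚ.*-monoˡ-≤ (value m) x+y≤ky))))

  monomial : ∀ {n} → Vec ℤ (suc n) → Carrier
  monomial z = power ℤ.∣ Vec.last z ∣

  last-∷ : ∀ {n} (i : ℤ) (z : Vec ℤ (suc n)) → Vec.last (i ∷ z) ≡ Vec.last z
  last-∷ i z with Vec.initLast z
  ... | _ , _ , _ = refl

  -- Induction along `s`. The invariant that the current ratio plus 1 is at most `k` passes on: i /
  -- m ≤ k gives i / m + 1 ≤ k + 1, matching the larger box for the remaining coordinates.
  total-points : ∀ {n} (s : Vec ℕ⁺ n) y x k → x ℕ.+ value y ℕ.≤ k ℕ.* value y →
    total monomial (List.filter (steps? (ratio (+ x) y) (s ∷ʳ 1⁺)) (box k (s ∷ʳ 1⁺))) ≋ weight s y x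
  total-points []      y x k h = total-step monomial power 1⁺ y x k [] h λ _ _ → identityʳ _
  total-points (m ∷ s) y x k h = total-step monomial (weight s m) m y x k (s ∷ʳ 1⁺) h λ i i≤km →
    ≋-trans (total-cong (λ z → ≋-reflexive (cong (λ j → power ℤ.∣ j ∣) (last-∷ (+ i) z)))
              (List.filter (steps? (ratio (+ i) m) (s ∷ʳ 1⁺)) (box (suc k) (s ∷ʳ 1⁺))))
      (total-points s m i (suc k)
        (subst (ℕ._≤ value m ℕ.+ k ℕ.* value m) (ℕₚ.+-comm (value m) i) (ℕₚ.+-monoʳ-≤ (value m) i≤km)))

  lectureHallPoint : ∀ {n} (s : Vec ℕ⁺ n) {z} → z ∈ Enumeration.elements (lectureHallPoints s) →
                     ¬ weight s 1⁺ 0 ≋ ε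
  lectureHallPoint s {z} z∈ with ∈-filter⁻ (steps? 0ℚ (s ∷ʳ 1⁺)) {xs = box 1 (s ∷ʳ 1⁺)} z∈
  ... | z∈box , st with box-ℕ 1 (s ∷ʳ 1⁺) z∈box
  ...   | z′ , refl = weight≉ε s 1⁺ 0 z′ st

  module _ (value : Polynomial → Carrier) (value-[] : value [] ≋ ε)
           (value-⊕ : ∀ p q → value (p ⊕ q) ≋ value p ∙ value q)
           (value-z^ : ∀ k → value (z^ k) ≋ power k) where

    -- Links the recursive weight to the polynomial through any additive map that sends powers of z
    -- to powers; it is used for coefficients and for evaluation. The starting ratio 0 is
    -- represented as 0 / 1.
    value-derangementPolynomial : ∀ {n} (s : Vec ℕ⁺ n) → value (derangementPolynomial s) ≋ weight s 1⁺ 0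
    value-derangementPolynomial s = ≋-trans (value-total (Enumeration.elements (lectureHallPoints s)))
      (total-points s 1⁺ 0 1 ℕₚ.≤-refl)
      where
      value-total : ∀ zs → value (List.foldr (λ z p → (z^ ℤ.∣ Vec.last z ∣) ⊕ p) [] zs) ≋ total monomial zs
      value-total []       = value-[]
      value-total (z ∷ zs) = ≋-trans (value-⊕ (z^ ℤ.∣ Vec.last z ∣) _)
        (∙-cong (value-z^ ℤ.∣ Vec.last z ∣) (value-total zs))

-- Coefficient sequences

-- f (k + s) / g k is weakly decreasing in k, multiplied out so that zeros are allowed.
RatioDecreasing : ℕ → (ℕ → ℕ) → (ℕ → ℕ) → Set
RatioDecreasing s f g = ∀ {k l} → k ℕ.≤ l → f (l ℕ.+ s) ℕ.* g k ℕ.≤ f (k ℕ.+ s) ℕ.* g l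

module Coefficients where

  times-z : (ℕ → ℕ) → ℕ → ℕ
  times-z f zero    = 0
  times-z f (suc k) = f k

  unit : ℕ → ℕ
  unit zero    = 1
  unit (suc _) = 0

  -- The second family starts at shift one so that `rotate` exchanges the two families. All shifts
  -- are carried because `rotate` changes them by one and `∙-≪-∙` needs `f` over `g` at positive
  -- shifts.
  _≪_ : (ℕ → ℕ) → (ℕ → ℕ) → Set
  f ≪ g = (∀ s → RatioDecreasing s f g) × (∀ s → RatioDecreasing (suc s) g f)

  decreasing-resp : ∀ {s f f′ g g′} → (∀ k → f k ≡ f′ k) → (∀ k → g k ≡ g′ k) →
                    RatioDecreasing s f g → RatioDecreasing s f′ g′
  decreasing-resp {s} e e′ r {k} {l} k≤l = ≡.subst₂ ℕ._≤_
    (≡.cong₂ ℕ._*_ (e (l ℕ.+ s)) (e′ k)) (≡.cong₂ ℕ._*_ (e (k ℕ.+ s)) (e′ l)) (r k≤l)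

  decreasing-+ˡ : ∀ {s f f′ g} → RatioDecreasing s f g → RatioDecreasing s f′ g →
                  RatioDecreasing s (λ k → f k ℕ.+ f′ k) g
  decreasing-+ˡ {s} {f} {f′} {g} r r′ {k} {l} k≤l = ≡.subst₂ ℕ._≤_
    (≡.sym (ℕₚ.*-distribʳ-+ (g k) (f (l ℕ.+ s)) (f′ (l ℕ.+ s))))
    (≡.sym (ℕₚ.*-distribʳ-+ (g l) (f (k ℕ.+ s)) (f′ (k ℕ.+ s))))
    (ℕₚ.+-mono-≤ (r k≤l) (r′ k≤l))

  decreasing-+ʳ : ∀ {s f g g′} → RatioDecreasing s f g → RatioDecreasing s f g′ →
                  RatioDecreasing s f (λ k → g k ℕ.+ g′ k)
  decreasing-+ʳ {s} {f} {g} {g′} r r′ {k} {l} k≤l = ≡.subst₂ ℕ._≤_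
    (≡.sym (ℕₚ.*-distribˡ-+ (f (l ℕ.+ s)) (g k) (g′ k)))
    (≡.sym (ℕₚ.*-distribˡ-+ (f (k ℕ.+ s)) (g l) (g′ l)))
    (ℕₚ.+-mono-≤ (r k≤l) (r′ k≤l))

  -- Multiplying the denominator by z uses up one unit of shift. At `k = 0` the left side vanishes,
  -- since `times-z g` starts with 0.
  decreasing-zʳ : ∀ {s f g} → RatioDecreasing (suc s) f g → RatioDecreasing s f (times-z g)
  decreasing-zʳ {s} {f} r {zero}  {l}     k≤l         = ℕₚ.≤-trans
    (ℕₚ.≤-reflexive (ℕₚ.*-zeroʳ (f (l ℕ.+ s)))) ℕ.z≤n
  decreasing-zʳ {s} {f} {g} r {suc k} {suc l} (ℕ.s≤s k≤l) = ≡.subst₂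
    (λ i j → f i ℕ.* g k ℕ.≤ f j ℕ.* g l) (ℕₚ.+-suc l s) (ℕₚ.+-suc k s) (r k≤l)

  decreasing-zˡ : ∀ {s f g} → RatioDecreasing s f g → RatioDecreasing (suc s) (times-z f) g
  decreasing-zˡ {s} {f} {g} r {k} {l} k≤l = ≡.subst₂
    (λ i j → times-z f i ℕ.* g k ℕ.≤ times-z f j ℕ.* g l)
    (≡.sym (ℕₚ.+-suc l s)) (≡.sym (ℕₚ.+-suc k s)) (r k≤l)

  decreasing-unit : ∀ s → RatioDecreasing s unit unit
  decreasing-unit s {zero}  {zero}  _ = ℕₚ.≤-refl
  decreasing-unit s {k}     {suc l} _ = ℕ.z≤n

  interlacing : InterlacingStructure
  interlacing = record
    { commutativeMonoid = Pointwise.commutativeMonoid ℕ ℕₚ.+-0-commutativeMonoid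
    ; shift      = times-z
    ; shift-∙    = λ { f g zero → refl ; f g (suc k) → refl }
    ; shift-ε    = λ { zero → refl ; (suc k) → refl }
    ; one        = unit
    ; _≪_        = _≪_
    ; ≪-resp     = λ e e′ (r , r′) → (λ s → decreasing-resp {s} e e′ (r s))
                                   , (λ s → decreasing-resp {suc s} e′ e (r′ s))
    ; ε-≪        = λ g → (λ s k≤l → ℕ.z≤n)
                       , (λ s {k} {l} k≤l → ℕₚ.≤-reflexive (≡.trans (ℕₚ.*-zeroʳ (g (l ℕ.+ suc s)))
                                                              (≡.sym (ℕₚ.*-zeroʳ (g (k ℕ.+ suc s))))))
    ; ≪-ε        = λ f → (λ s {k} {l} k≤l → ℕₚ.≤-reflexive (≡.trans (ℕₚ.*-zeroʳ (f (l ℕ.+ s)))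
                                                              (≡.sym (ℕₚ.*-zeroʳ (f (k ℕ.+ s))))))
                       , (λ s k≤l → ℕ.z≤n)
    ; ∙-≪        = λ {f} {f′} {g} (p , p′) (q , q′) →
                       (λ s → decreasing-+ˡ {s} {f} {f′} {g} (p s) (q s))
                     , (λ s → decreasing-+ʳ {suc s} {g} {f} {f′} (p′ s) (q′ s))
    ; ≪-∙        = λ {f} {g} {g′} (p , p′) (q , q′) →
                       (λ s → decreasing-+ʳ {s} {f} {g} {g′} (p s) (q s))
                     , (λ s → decreasing-+ˡ {suc s} {g} {g′} {f} (p′ s) (q′ s))
    -- Expanding f + g against itself at shift `suc s` gives four terms; the mixed ones are
    -- `fg (suc s)` and `gf s`, one from each half of `f ≪ g`.
    ; ∙-≪-∙      = λ {f} {g} (_ , ff) (_ , gg) (fg , gf) → reflexive {λ k → f k ℕ.+ g k} λ s →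
                     decreasing-+ˡ {suc s} {f} {g} {λ k → f k ℕ.+ g k}
                       (decreasing-+ʳ {suc s} {f} {f} {g} (ff s) (fg (suc s)))
                       (decreasing-+ʳ {suc s} {g} {f} {g} (gf s) (gg s))
    ; rotate     = λ {f} {g} (r , r′) → (λ s → decreasing-zʳ {s} {g} {f} (r′ s))
                                      , (λ s → decreasing-zˡ {s} {f} {g} (r s))
    ; one-≪      = decreasing-unit , λ s → decreasing-unit (suc s)
    ; ∙-zero     = λ {f} {g} _ e → (λ k → ℕₚ.m+n≡0⇒m≡0 (f k) (e k)) , (λ k → ℕₚ.m+n≡0⇒n≡0 (f k) (e k))
    ; shift-zero = λ e k → e (suc k)
    ; one≉ε      = λ e → ℕₚ.1+n≢0 (e 0)
    }
    where
    -- At shift zero the two products of a sequence with itself agree by commutativity, so the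
    -- positive shifts decide.
    reflexive : ∀ {f} → (∀ s → RatioDecreasing (suc s) f f) → f ≪ f
    reflexive {f} r = shifted , r
      where
      shifted : ∀ s → RatioDecreasing s f f
      shifted zero {k} {l} _ = ℕₚ.≤-reflexive (≡.trans
        (cong (λ i → f i ℕ.* f k) (ℕₚ.+-identityʳ l))
        (≡.trans (ℕₚ.*-comm (f l) (f k)) (cong (λ i → f i ℕ.* f l) (≡.sym (ℕₚ.+-identityʳ k)))))
      shifted (suc s) = r s

  open Windows interlacing

  coeff-⊕ : ∀ p q k → coeff (p ⊕ q) k ≡ coeff p k ℕ.+ coeff q k
  coeff-⊕ []      q       k       = refl
  coeff-⊕ (a ∷ p) []      k       = ≡.sym (ℕₚ.+-identityʳ (coeff (a ∷ p) k))
  coeff-⊕ (a ∷ p) (b ∷ q) zero    = refl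
  coeff-⊕ (a ∷ p) (b ∷ q) (suc k) = coeff-⊕ p q k

  coeff-z^ : ∀ i k → coeff (z^ i) k ≡ power i k
  coeff-z^ zero    zero    = refl
  coeff-z^ zero    (suc k) = refl
  coeff-z^ (suc i) zero    = refl
  coeff-z^ (suc i) (suc k) = coeff-z^ i k

  derangement-decreasing : ∀ {n} (s : Vec ℕ⁺ n) →
    RatioDecreasing 1 (coeff (derangementPolynomial s)) (coeff (derangementPolynomial s))
  derangement-decreasing s = decreasing-resp {1} {weight s 1⁺ 0} e e
    -- The diagonal case i = j = 0, whose second half at `s = 0` is shift one.
    (proj₂ (Admissible.local (weight-admissible s 1⁺) {0} ℕₚ.≤-refl ℕ.z≤n) 0)
    where
    e = λ k → ≡.sym (value-derangementPolynomial coeff (λ _ → refl) coeff-⊕ coeff-z^ s k)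

  decreasing⇒logConcave : ∀ p → RatioDecreasing 1 (coeff p) (coeff p) → LogConcave p
  decreasing⇒logConcave p r k = ≡.subst₂ ℕ._≤_
    (≡.trans (cong (λ i → coeff p i ℕ.* coeff p k) (ℕₚ.+-comm (suc k) 1)) (ℕₚ.*-comm _ (coeff p k)))
    (cong (λ i → coeff p i ℕ.* coeff p (suc k)) (ℕₚ.+-comm k 1))
    (r (ℕₚ.n≤1+n k))

  coeff-above : ∀ p {k} → List.length p ℕ.≤ k → coeff p k ≡ 0
  coeff-above []      _           = refl
  coeff-above (a ∷ p) (ℕ.s≤s p≤k) = coeff-above p p≤k

  -- Let `t` be the first strict descent. Then p_t > 0, and for k ≥ t the inequalities p_(k+1) p_t ≤
  -- p_(t+1) p_k ≤ p_t p_k allow cancelling p_t. Using distant `k` and `t` excludes internal zeros,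
  -- which `LogConcave` alone would permit. If there is no descent below the length, the length
  -- itself serves as the mode.
  decreasing⇒unimodal : ∀ p → RatioDecreasing 1 (coeff p) (coeff p) → Unimodal p
  decreasing⇒unimodal p r with search (List.length p)
    where
    search : ∀ b → (∃ λ t → (∀ k → k ℕ.< t → coeff p k ℕ.≤ coeff p (suc k)) × coeff p (suc t) ℕ.< coeff p t)
                   ⊎ (∀ k → k ℕ.< b → coeff p k ℕ.≤ coeff p (suc k))
    search zero    = inj₂ λ _ ()
    search (suc b) with search b
    ... | inj₁ found = inj₁ found
    ... | inj₂ up with coeff p b ℕₚ.≤? coeff p (suc b)
    ...   | no b≰ = inj₁ (b , up , ℕₚ.≰⇒> b≰)
    ...   | yes b≤ = inj₂ λ k k<1+b → step k (ℕₚ.m≤n⇒m<n∨m≡n (ℕ.s≤s⁻¹ k<1+b))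
      where
      step : ∀ k → k ℕ.< b ⊎ k ≡ b → coeff p k ℕ.≤ coeff p (suc k)
      step k (inj₁ k<b)  = up k k<b
      step k (inj₂ refl) = b≤
  ... | inj₂ up = List.length p , up , λ k p≤k →
        ℕₚ.≤-trans (ℕₚ.≤-reflexive (coeff-above p (ℕₚ.m≤n⇒m≤1+n p≤k))) ℕ.z≤n
  ... | inj₁ (t , up , drop) = t , up , λ k t≤k → ℕₚ.*-cancelʳ-≤ _ _ (coeff p t) {{ℕ.>-nonZero (ℕₚ.≤-<-trans ℕ.z≤n drop)}}
        (ℕₚ.≤-trans (≡.subst₂ ℕ._≤_
            (cong (λ i → coeff p i ℕ.* coeff p t) (ℕₚ.+-comm k 1))
            (≡.trans (cong (λ i → coeff p i ℕ.* coeff p k) (ℕₚ.+-comm t 1)) (ℕₚ.*-comm _ (coeff p k)))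
            (r t≤k))
          (ℕₚ.*-monoʳ-≤ (coeff p k) (ℕₚ.<⇒≤ drop)))

-- Real numbers

½*< : ∀ {ε} → 0ℚ ℚ.< ε → ½ ℚ.* ε ℚ.< ε
½*< {ε} ε>0 = subst₂ ℚ._<_ (ℚₚ.+-identityʳ (½ ℚ.* ε)) (½+½ ε) (ℚₚ.+-monoʳ-< (½ ℚ.* ε) (0<½* ε>0))

0<* : ∀ {p q} → 0ℚ ℚ.< p → 0ℚ ℚ.< q → 0ℚ ℚ.< p ℚ.* q
0<* {p} {q} p>0 q>0 = ℚₚ.positive⁻¹ (p ℚ.* q) {{ℚₚ.pos*pos⇒pos p {{ℚ.positive p>0}} q {{ℚ.positive q>0}}}}

int-+ : ∀ i j → (i ℤ.+ j) ℚ./ 1 ≡ (i ℚ./ 1) ℚ.+ (j ℚ./ 1)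
int-+ i j = ℚₚ.toℚᵘ-injective (ℚᵘₚ.≃-trans (toℚᵘ-int (i ℤ.+ j)) (ℚᵘₚ.≃-sym
  (ℚᵘₚ.≃-trans (ℚₚ.toℚᵘ-homo-+ (i ℚ./ 1) (j ℚ./ 1))
    (ℚᵘₚ.≃-trans (ℚᵘₚ.+-cong (toℚᵘ-int i) (toℚᵘ-int j))
      (*≡* (cong (ℤ._* + 1) (≡.cong₂ ℤ._+_ (ℤₚ.*-identityʳ i) (ℤₚ.*-identityʳ j))))))))

≤-respʳ : ∀ {x y z} → y ≈ z → x ≤ y → x ≤ z
≤-respʳ y≈z x≤y = ≤-trans x≤y (≈⇒≤ y≈z)

+-nonNeg : ∀ {x y} → 0ℝ ≤ x → 0ℝ ≤ y → 0ℝ ≤ x + y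
+-nonNeg {x} 0≤x 0≤y = ≤-trans 0≤x (≤-trans (≈⇒≤ (≈-sym (+-identityʳ x))) (+-monoʳ-≤ x 0≤y))

-- A nonnegative real is known only through x > -δ; the bound c < A and the choice A δ = ε / 2 keep
-- the error of the product below ε.
pos*nonNeg-estimate : ∀ {A γ ε δ} → 0ℚ ℚ.< γ → 0ℚ ℚ.< ε → 0ℚ ℚ.< δ → A ℚ.* δ ≡ ½ ℚ.* ε → ∀ c x →
  0ℚ ℚ.+ γ ℚ.< c → ℚ.∣ c ∣ ℚ.< A → 0ℚ ℚ.< x ℚ.+ δ → 0ℚ ℚ.< c ℚ.* x ℚ.+ ε
pos*nonNeg-estimate {A} {γ} {ε} {δ} γ>0 ε>0 δ>0 e c x γ<c c<A 0<x+δ = ℚₚ.≤-<-trans 0≤ <ε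
  where
  0<c : 0ℚ ℚ.< c
  0<c = ℚₚ.<-trans (subst (0ℚ ℚ.<_) (≡.sym (ℚₚ.+-identityˡ γ)) γ>0) γ<c
  cδ≤½ε : c ℚ.* δ ℚ.≤ ½ ℚ.* ε
  cδ≤½ε = subst (c ℚ.* δ ℚ.≤_) e (ℚₚ.*-monoʳ-≤-nonNeg δ {{ℚ.nonNegative (ℚₚ.<⇒≤ δ>0)}}
            (ℚₚ.<⇒≤ (∣p∣<⇒p< {c} c<A)))
  0≤ : 0ℚ ℚ.≤ c ℚ.* x ℚ.+ c ℚ.* δ
  0≤ = subst₂ ℚ._≤_ (ℚₚ.*-zeroʳ c) (ℚₚ.*-distribˡ-+ c x δ)
         (ℚₚ.*-monoˡ-≤-nonNeg c {{ℚ.nonNegative (ℚₚ.<⇒≤ 0<c)}} (ℚₚ.<⇒≤ 0<x+δ))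
  <ε : c ℚ.* x ℚ.+ c ℚ.* δ ℚ.< c ℚ.* x ℚ.+ ε
  <ε = ℚₚ.+-monoʳ-< (c ℚ.* x) (ℚₚ.≤-<-trans cδ≤½ε (½*< ε>0))

pos*nonNeg : ∀ {c x} → 0ℝ < c → 0ℝ ≤ x → 0ℝ ≤ c * x
pos*nonNeg {c} {x} (mk< {γ} γ>0 γ<c) 0≤x = mk≤ λ {ε} ε>0 →
  let A , A>0 , c<A = bounded c
      δ , δ>0 , Aδ≡½ε = scaled A A>0 ε>0
  in both (λ {n} (p , q) r → pos*nonNeg-estimate {A} {γ} {ε} {δ} γ>0 ε>0 δ>0 Aδ≡½ε (seq c n) (seq x n) p q r)
       (both {λ n → seq 0ℝ n ℚ.+ γ ℚ.< seq c n} {λ n → ℚ.∣ seq c n ∣ ℚ.< A} _,_ γ<c c<A) (below 0≤x δ>0)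

square≥0 : ∀ p → 0ℚ ℚ.≤ p ℚ.* p
square≥0 p with ℚₚ.≤-total 0ℚ p
... | inj₁ 0≤p = subst (ℚ._≤ p ℚ.* p) (ℚₚ.*-zeroʳ p) (ℚₚ.*-monoˡ-≤-nonNeg p {{ℚ.nonNegative 0≤p}} 0≤p)
... | inj₂ p≤0 = subst (ℚ._≤ p ℚ.* p) (ℚₚ.*-zeroʳ p) (ℚₚ.*-monoˡ-≤-nonPos p {{ℚ.nonPositive p≤0}} p≤0)

square≤sum : ∀ p q → p ℚ.* p ℚ.≤ p ℚ.* p ℚ.+ q ℚ.* q
square≤sum p q = subst (ℚ._≤ p ℚ.* p ℚ.+ q ℚ.* q) (ℚₚ.+-identityʳ (p ℚ.* p))
  (ℚₚ.+-monoʳ-≤ (p ℚ.* p) (square≥0 q))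

pointwise-nonNeg : ∀ {x} → (∀ n → 0ℚ ℚ.≤ seq x n) → 0ℝ ≤ x
pointwise-nonNeg {x} h = mk≤ λ {ε} ε>0 → 0 , λ {n} _ →
  ℚₚ.≤-<-trans (h n) (subst (ℚ._< seq x n ℚ.+ ε) (ℚₚ.+-identityʳ (seq x n)) (ℚₚ.+-monoʳ-< (seq x n) ε>0))

squares≥0 : ∀ x y → 0ℝ ≤ x * x + y * y
squares≥0 x y = pointwise-nonNeg {x * x + y * y} λ n →
  ℚₚ.≤-trans (square≥0 (seq x n)) (square≤sum (seq x n) (seq y n))

squares>0 : ∀ x {y} → 0ℝ < y → 0ℝ < x * x + y * y
squares>0 x {y} (mk< {γ} γ>0 (N , p)) = mk< (0<* γ>0 γ>0) (N , λ {n} h →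
  subst₂ ℚ._<_ (≡.sym (ℚₚ.+-identityˡ (γ ℚ.* γ))) (ℚₚ.+-comm (seq y n ℚ.* seq y n) _)
    (ℚₚ.<-≤-trans (γγ< (seq y n) (p h)) (square≤sum (seq y n) (seq x n))))
  where
  γγ< : ∀ q → 0ℚ ℚ.+ γ ℚ.< q → γ ℚ.* γ ℚ.< q ℚ.* q
  γγ< q γ<q = ℚₚ.<-trans
    (ℚₚ.*-monoʳ-<-pos γ {{ℚ.positive γ>0}} γ<q′)
    (ℚₚ.*-monoˡ-<-pos q {{ℚ.positive (ℚₚ.<-trans γ>0 γ<q′)}} γ<q′)
    where γ<q′ = subst (ℚ._< q) (ℚₚ.+-identityˡ γ) γ<q

-- The gap `γ` bounds `c` from below, so |x| ≥ ε at a late index would give c (x² + y²) ≥ γ ε².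
-- Hence `h` is used with tolerance γ ε².
squares-zero : ∀ {c} x y → 0ℝ < c → c * (x * x + y * y) ≤ 0ℝ → x ≈ 0ℝ
squares-zero {c} x y (mk< {γ} γ>0 c>) h = mk≈ λ {ε} ε>0 →
  both (λ {n} → estimate ε>0 (seq c n) (seq x n) (seq y n)) c> (below h (0<* γ>0 (0<* ε>0 ε>0)))
  where
  estimate : ∀ {ε} → 0ℚ ℚ.< ε → ∀ c x y → 0ℚ ℚ.+ γ ℚ.< c →
    c ℚ.* (x ℚ.* x ℚ.+ y ℚ.* y) ℚ.< 0ℚ ℚ.+ γ ℚ.* (ε ℚ.* ε) → ℚ.∣ x ℚ.- 0ℚ ∣ ℚ.< ε
  estimate {ε} ε>0 c x y γ<c h = subst (λ p → ℚ.∣ p ∣ ℚ.< ε) (≡.sym (ℚₚ.+-identityʳ x))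
    (ℚₚ.≰⇒> λ ε≤∣x∣ → ℚₚ.<-irrefl refl (ℚₚ.<-≤-trans h (begin
      0ℚ ℚ.+ γ ℚ.* (ε ℚ.* ε)
        ≡⟨ ℚₚ.+-identityˡ _ ⟩
      γ ℚ.* (ε ℚ.* ε)
        ≤⟨ ℚₚ.*-monoˡ-≤-nonNeg γ {{γ≥0}} (ℚₚ.*-monoʳ-≤-nonNeg ε {{ℚ.nonNegative (ℚₚ.<⇒≤ ε>0)}} ε≤∣x∣) ⟩
      γ ℚ.* (ℚ.∣ x ∣ ℚ.* ε)
        ≤⟨ ℚₚ.*-monoˡ-≤-nonNeg γ {{γ≥0}} (ℚₚ.*-monoˡ-≤-nonNeg ℚ.∣ x ∣ {{ℚₚ.∣-∣-nonNeg x}} ε≤∣x∣) ⟩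
      γ ℚ.* (ℚ.∣ x ∣ ℚ.* ℚ.∣ x ∣)
        ≡⟨ cong (γ ℚ.*_) (≡.trans (≡.sym (ℚₚ.∣p*q∣≡∣p∣*∣q∣ x x)) (ℚₚ.0≤p⇒∣p∣≡p (square≥0 x))) ⟩
      γ ℚ.* (x ℚ.* x)
        ≤⟨ ℚₚ.*-monoˡ-≤-nonNeg γ {{γ≥0}} (square≤sum x y) ⟩
      γ ℚ.* (x ℚ.* x ℚ.+ y ℚ.* y)
        ≤⟨ ℚₚ.*-monoʳ-≤-nonNeg _ {{ℚ.nonNegative (ℚₚ.≤-trans (square≥0 x) (square≤sum x y))}}
             (ℚₚ.<⇒≤ (subst (ℚ._< c) (ℚₚ.+-identityˡ γ) γ<c)) ⟩
      c ℚ.* (x ℚ.* x ℚ.+ y ℚ.* y)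
        ∎)))
    where
    open ℚₚ.≤-Reasoning
    γ≥0 = ℚ.nonNegative (ℚₚ.<⇒≤ γ>0)

-- The order on the reals is not decided; instead one rational term, past which the sequence varies
-- by less than ε / 4, is compared with ε / 2. If it is smaller, all later terms are below ε;
-- otherwise they all exceed ε / 4, contradicting the hypothesis.
≮⇒≤0 : ∀ {x} → ¬ 0ℝ < x → x ≤ 0ℝ
≮⇒≤0 {x} x≯0 = mk≤ λ {ε} ε>0 → bound ε>0
  where
  bound : ∀ {ε} → 0ℚ ℚ.< ε → Eventually λ n → seq x n ℚ.< 0ℚ ℚ.+ ε
  bound {ε} ε>0 with cauchy x (0<½* (0<½* ε>0))
  ... | N , c with seq x N ℚₚ.<? ½ ℚ.* ε
  ...   | yes xN< = N , λ {n} h → subst (seq x n ℚ.<_) (≡.sym (ℚₚ.+-identityˡ ε))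
            (subst (seq x n ℚ.<_) (½+½ ε) (ℚₚ.<-trans (shift-< (∣p∣<⇒p< (c h ℕₚ.≤-refl)))
              (ℚₚ.+-mono-< xN< (½*< (0<½* ε>0)))))
  ...   | no xN≮ = contradiction (mk< (0<½* (0<½* ε>0)) (N , λ {n} h →
            cancel-+-< η (begin-strict
              0ℚ ℚ.+ η ℚ.+ η    ≡⟨ cong (ℚ._+ η) (ℚₚ.+-identityˡ η) ⟩
              η ℚ.+ η           ≡⟨ ½+½ (½ ℚ.* ε) ⟩
              ½ ℚ.* ε           ≤⟨ ℚₚ.≮⇒≥ xN≮ ⟩
              seq x N           <⟨ shift-< (∣p∣<⇒p< (c ℕₚ.≤-refl h)) ⟩
              seq x n ℚ.+ η     ∎))) x≯0
    where
    open ℚₚ.≤-Reasoning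
    η = ½ ℚ.* (½ ℚ.* ε)

≤0∧-≤0⇒≈0 : ∀ {x} → x ≤ 0ℝ → - x ≤ 0ℝ → x ≈ 0ℝ
≤0∧-≤0⇒≈0 {x} x≤0 -x≤0 = mk≈ λ {ε} ε>0 →
  both (λ {n} → estimate (seq x n)) (below x≤0 ε>0) (below -x≤0 ε>0)
  where
  estimate : ∀ {ε} p → p ℚ.< 0ℚ ℚ.+ ε → ℚ.- p ℚ.< 0ℚ ℚ.+ ε → ℚ.∣ p ℚ.- 0ℚ ∣ ℚ.< ε
  estimate {ε} p p< -p< with ℚₚ.∣p∣≡p∨∣p∣≡-p p
  ... | inj₁ e = subst₂ ℚ._<_ (≡.trans (≡.sym e) (cong ℚ.∣_∣ (≡.sym (ℚₚ.+-identityʳ p)))) (ℚₚ.+-identityˡ ε) p<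
  ... | inj₂ e = subst₂ ℚ._<_ (≡.trans (≡.sym e) (cong ℚ.∣_∣ (≡.sym (ℚₚ.+-identityʳ p)))) (ℚₚ.+-identityˡ ε) -p<

-- Values in the upper half plane

infix 4 _≈ᶜ_

record _≈ᶜ_ (u v : ℂ) : Set where
  constructor _+i_
  field
    re-≈ : re u ≈ re v
    im-≈ : im u ≈ im v

open _≈ᶜ_

0ᶜ 1ᶜ : ℂ
0ᶜ = 0ℝ +i 0ℝ
1ᶜ = 1ℝ +i 0ℝ

ℂ-+-commutativeMonoid : CommutativeMonoid 0ℓ 0ℓ
ℂ-+-commutativeMonoid = record
  { Carrier = ℂ ; _≈_ = _≈ᶜ_ ; _∙_ = _+ᶜ_ ; ε = 0ᶜ
  ; isCommutativeMonoid = record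
    { isMonoid = record
      { isSemigroup = record
        { isMagma = record
          { isEquivalence = record
            { refl  = ≈-refl +i ≈-refl
            ; sym   = λ (e +i f) → ≈-sym e +i ≈-sym f
            ; trans = λ (e +i f) (g +i h) → ≈-trans e g +i ≈-trans f h
            }
          ; ∙-cong = λ (e +i f) (g +i h) → +-cong e g +i +-cong f h
          }
        ; assoc = λ (a +i b) (c +i d) (e +i f) → ℝ-ring.+-assoc a c e +i ℝ-ring.+-assoc b d f
        }
      ; identity = (λ (a +i b) → ℝ-ring.+-identityˡ a +i ℝ-ring.+-identityˡ b)
                 , (λ (a +i b) → ℝ-ring.+-identityʳ a +i ℝ-ring.+-identityʳ b)
      }
    ; comm = λ (a +i b) (c +i d) → ℝ-ring.+-comm a c +i ℝ-ring.+-comm b d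
    }
  }

private
  module M = CommutativeMonoid ℂ-+-commutativeMonoid

*ᶜ-congˡ : ∀ w {u v} → u ≈ᶜ v → w *ᶜ u ≈ᶜ w *ᶜ v
*ᶜ-congˡ w (e +i f) = +-cong (*-cong ≈-refl e) (-‿cong (*-cong ≈-refl f))
                   +i +-cong (*-cong ≈-refl f) (*-cong ≈-refl e)

*ᶜ-distribˡ : ∀ w u v → w *ᶜ (u +ᶜ v) ≈ᶜ w *ᶜ u +ᶜ w *ᶜ v
*ᶜ-distribˡ (a +i b) (c +i d) (e +i f) =
     (pointwise λ n → solve 6 (λ a b c d e f → a :* (c :+ e) :- b :* (d :+ f)
                                            := (a :* c :- b :* d) :+ (a :* e :- b :* f))
       refl (seq a n) (seq b n) (seq c n) (seq d n) (seq e n) (seq f n))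
  +i (pointwise λ n → solve 6 (λ a b c d e f → a :* (d :+ f) :+ b :* (c :+ e)
                                            := (a :* d :+ b :* c) :+ (a :* f :+ b :* e))
       refl (seq a n) (seq b n) (seq c n) (seq d n) (seq e n) (seq f n))

*ᶜ-zeroʳ : ∀ w → w *ᶜ 0ᶜ ≈ᶜ 0ᶜ
*ᶜ-zeroʳ (a +i b) =
     (pointwise λ n → solve 2 (λ a b → a :* con 0ℚ :- b :* con 0ℚ := con 0ℚ) refl (seq a n) (seq b n))
  +i (pointwise λ n → solve 2 (λ a b → a :* con 0ℚ :+ b :* con 0ℚ := con 0ℚ) refl (seq a n) (seq b n))

-- The imaginary part of the conjugate of `u` times `v`: it is nonnegative when `v` lies within a
-- half turn counterclockwise from `u`.
cross : ℂ → ℂ → ℝ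
cross u v = re u * im v - im u * re v

cross-cong : ∀ {u u′ v v′} → u ≈ᶜ u′ → v ≈ᶜ v′ → cross u v ≈ cross u′ v′
cross-cong (e +i f) (g +i h) = +-cong (*-cong e h) (-‿cong (*-cong f g))

cross-+ˡ : ∀ u u′ v → cross (u +ᶜ u′) v ≈ cross u v + cross u′ v
cross-+ˡ (a +i b) (c +i d) (e +i f) = pointwise λ n →
  solve 6 (λ a b c d e f → (a :+ c) :* f :- (b :+ d) :* e := (a :* f :- b :* e) :+ (c :* f :- d :* e))
    refl (seq a n) (seq b n) (seq c n) (seq d n) (seq e n) (seq f n)

cross-+ʳ : ∀ u v v′ → cross u (v +ᶜ v′) ≈ cross u v + cross u v′
cross-+ʳ (a +i b) (c +i d) (e +i f) = pointwise λ n →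
  solve 6 (λ a b c d e f → a :* (d :+ f) :- b :* (c :+ e) := (a :* d :- b :* c) :+ (a :* f :- b :* e))
    refl (seq a n) (seq b n) (seq c n) (seq d n) (seq e n) (seq f n)

cross-0ˡ : ∀ v → cross 0ᶜ v ≈ 0ℝ
cross-0ˡ (a +i b) = pointwise λ n →
  solve 2 (λ a b → con 0ℚ :* b :- con 0ℚ :* a := con 0ℚ) refl (seq a n) (seq b n)

cross-0ʳ : ∀ u → cross u 0ᶜ ≈ 0ℝ
cross-0ʳ (a +i b) = pointwise λ n →
  solve 2 (λ a b → a :* con 0ℚ :- b :* con 0ℚ := con 0ℚ) refl (seq a n) (seq b n)

cross-self : ∀ u → cross u u ≈ 0ℝ
cross-self (a +i b) = pointwise λ n →
  solve 2 (λ a b → a :* b :- b :* a := con 0ℚ) refl (seq a n) (seq b n)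

cross-* : ∀ w u v → cross (w *ᶜ u) (w *ᶜ v) ≈ (re w * re w + im w * im w) * cross u v
cross-* (a +i b) (c +i d) (e +i f) = pointwise λ n →
  solve 6 (λ a b c d e f →
      (a :* c :- b :* d) :* (a :* f :+ b :* e) :- (a :* d :+ b :* c) :* (a :* e :- b :* f)
      := (a :* a :+ b :* b) :* (c :* f :- d :* e))
    refl (seq a n) (seq b n) (seq c n) (seq d n) (seq e n) (seq f n)

-- This is Im w times the squared modulus of `u`: for Im w > 0 it is nonnegative, and it vanishes
-- only at `u` = 0.
cross-self-* : ∀ w u → cross u (w *ᶜ u) ≈ im w * (re u * re u + im u * im u)
cross-self-* (a +i b) (c +i d) = pointwise λ n →
  solve 4 (λ a b c d → c :* (a :* d :+ b :* c) :- d :* (a :* c :- b :* d) := b :* (c :* c :+ d :* d))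
    refl (seq a n) (seq b n) (seq c n) (seq d n)

-- Evaluation of polynomials and conjugation

eval-⊕ : ∀ p q w → eval (p ⊕ q) w ≈ᶜ eval p w +ᶜ eval q w
eval-⊕ []      q       w = M.sym (M.identityˡ (eval q w))
eval-⊕ (a ∷ p) []      w = M.sym (M.identityʳ (eval (a ∷ p) w))
eval-⊕ (a ∷ p) (b ∷ q) w = begin
  const (a ℕ.+ b) +ᶜ w *ᶜ eval (p ⊕ q) w
    ≈⟨ M.∙-cong const-+ (M.trans (*ᶜ-congˡ w (eval-⊕ p q w)) (*ᶜ-distribˡ w (eval p w) (eval q w))) ⟩
  (const a +ᶜ const b) +ᶜ (w *ᶜ eval p w +ᶜ w *ᶜ eval q w)
    ≈⟨ interchange (const a) (const b) (w *ᶜ eval p w) (w *ᶜ eval q w) ⟩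
  (const a +ᶜ w *ᶜ eval p w) +ᶜ (const b +ᶜ w *ᶜ eval q w)
    ∎
  where
  open SetoidReasoning M.setoid
  open CommutativeSemigroupₚ M.commutativeSemigroup using (interchange)
  const : ℕ → ℂ
  const a = fromℤ (+ a) +i 0ℝ
  const-+ : const (a ℕ.+ b) ≈ᶜ const a +ᶜ const b
  const-+ = (pointwise λ _ → int-+ (+ a) (+ b)) +i (pointwise λ _ → refl)

conj : ℂ → ℂ
conj (a +i b) = a +i (- b)

conj-+* : ∀ {a u v} w → u ≈ᶜ conj v → (a +i 0ℝ) +ᶜ conj w *ᶜ u ≈ᶜ conj ((a +i 0ℝ) +ᶜ w *ᶜ v)
conj-+* {a} {u} {c +i d} w@(x +i y) e =
     ≈-trans (+-cong (≈-refl {a}) (re-≈ (*ᶜ-congˡ (conj w) e))) (pointwise λ n →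
       solve 5 (λ a c d x y → a :+ (x :* c :- (:- y) :* (:- d)) := a :+ (x :* c :- y :* d)) refl
         (seq a n) (seq c n) (seq d n) (seq x n) (seq y n))
  +i ≈-trans (+-cong (≈-refl {0ℝ}) (im-≈ (*ᶜ-congˡ (conj w) e))) (pointwise λ n →
       solve 4 (λ c d x y → con 0ℚ :+ (x :* (:- d) :+ (:- y) :* c) := :- (con 0ℚ :+ (x :* d :+ y :* c))) refl
         (seq c n) (seq d n) (seq x n) (seq y n))

-- The coefficients are real, so zeros come in conjugate pairs and the lower half plane reduces to
-- the upper one.
eval-conj : ∀ p w → eval p (conj w) ≈ᶜ conj (eval p w)
eval-conj []      w = ≈-refl +i (pointwise λ _ → refl)
eval-conj (a ∷ p) w = conj-+* w (eval-conj p w)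

module UpperHalfPlane (w : ℂ) (w>0 : 0ℝ < im w) where

  _≪_ : ℂ → ℂ → Set
  u ≪ v = 0ℝ ≤ cross u v × 0ℝ ≤ cross v (w *ᶜ u)

  ≪-refl : ∀ u → u ≪ u
  ≪-refl u = ≈⇒≤ (≈-sym (cross-self u))
           , ≤-respʳ (≈-sym (cross-self-* w u)) (pos*nonNeg w>0 (squares≥0 (re u) (im u)))

  cross≤0⇒zero : ∀ u → cross u (w *ᶜ u) ≤ 0ℝ → u ≈ᶜ 0ᶜ
  cross≤0⇒zero u h =
       squares-zero (re u) (im u) w>0 (≤-trans (≈⇒≤ (≈-sym (cross-self-* w u))) h)
    +i squares-zero (im u) (re u) w>0 (≤-trans (≈⇒≤ (≈-trans
         (*-cong ≈-refl (ℝ-ring.+-comm (im u * im u) (re u * re u))) (≈-sym (cross-self-* w u)))) h)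

  interlacing : InterlacingStructure
  interlacing = record
    { commutativeMonoid = ℂ-+-commutativeMonoid
    ; shift      = w *ᶜ_
    ; shift-∙    = *ᶜ-distribˡ w
    ; shift-ε    = *ᶜ-zeroʳ w
    ; one        = 1ᶜ
    ; _≪_        = _≪_
    ; ≪-resp     = λ e f (p , q) → ≤-respʳ (cross-cong e f) p , ≤-respʳ (cross-cong f (*ᶜ-congˡ w e)) q
    ; ε-≪        = λ v → ≈⇒≤ (≈-sym (cross-0ˡ v))
                       , ≈⇒≤ (≈-sym (≈-trans (cross-cong (M.refl {v}) (*ᶜ-zeroʳ w)) (cross-0ʳ v)))
    ; ≪-ε        = λ u → ≈⇒≤ (≈-sym (cross-0ʳ u)) , ≈⇒≤ (≈-sym (cross-0ˡ (w *ᶜ u)))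
    ; ∙-≪        = λ {u} {u′} {v} (p , q) (p′ , q′) →
                       ≤-respʳ (≈-sym (cross-+ˡ u u′ v)) (+-nonNeg p p′)
                     , ≤-respʳ (≈-sym (≈-trans (cross-cong (M.refl {v}) (*ᶜ-distribˡ w u u′))
                                               (cross-+ʳ v (w *ᶜ u) (w *ᶜ u′)))) (+-nonNeg q q′)
    ; ≪-∙        = λ {u} {v} {v′} (p , q) (p′ , q′) →
                       ≤-respʳ (≈-sym (cross-+ʳ u v v′)) (+-nonNeg p p′)
                     , ≤-respʳ (≈-sym (cross-+ˡ v v′ (w *ᶜ u))) (+-nonNeg q q′)
    ; ∙-≪-∙      = λ {u} {v} _ _ _ → ≪-refl (u +ᶜ v)
    -- The new second condition compares w u with w v; multiplying both by `w` scales `cross` by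
    -- |w|² > 0.
    ; rotate     = λ {u} {v} (p , q) → q
                     , ≤-respʳ (≈-sym (cross-* w u v)) (pos*nonNeg (squares>0 (re w) w>0) p)
    ; one-≪      = ≪-refl 1ᶜ
    ; ∙-zero     = ∙-zero
    ; shift-zero = λ {u} e → cross≤0⇒zero u (≈⇒≤ (≈-trans (cross-cong (M.refl {u}) e) (cross-0ʳ u)))
    ; one≉ε      = λ (e +i _) → let N , p = close e 0<1 in ℚₚ.<-irrefl refl (p {N} ℕₚ.≤-refl)
    }
    where
    0<1 : 0ℚ ℚ.< 1ℚ
    0<1 = ℚₚ.positive⁻¹ 1ℚ
    -- With u + v = 0, the sum of `cross u (w *ᶜ u)` and `cross v (w *ᶜ u)` is zero. The second is
    -- nonnegative by `u ≪ v`, so the first is at most zero, which forces `u` to vanish.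
    ∙-zero : ∀ {u v} → u ≪ v → u +ᶜ v ≈ᶜ 0ᶜ → u ≈ᶜ 0ᶜ × v ≈ᶜ 0ᶜ
    ∙-zero {u} {v} (_ , 0≤) e = u≈0 ,
      M.trans (M.sym (M.identityˡ v)) (M.trans (M.∙-congʳ (M.sym u≈0)) e)
      where
      u≈0 : u ≈ᶜ 0ᶜ
      u≈0 = cross≤0⇒zero u (≤-trans
        (≈⇒≤ (≈-sym (+-identityʳ _)))
        (≤-trans (+-monoʳ-≤ (cross u (w *ᶜ u)) 0≤)
          (≈⇒≤ (≈-trans (≈-sym (cross-+ˡ u v (w *ᶜ u)))
                 (≈-trans (cross-cong e (M.refl {w *ᶜ u})) (cross-0ˡ (w *ᶜ u)))))))

  open Windows interlacing

  eval-z^ : ∀ k → eval (z^ k) w ≈ᶜ power k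
  eval-z^ zero    = M.trans (M.∙-congˡ (*ᶜ-zeroʳ w)) (M.identityʳ 1ᶜ)
  eval-z^ (suc k) = M.trans (M.identityˡ _) (*ᶜ-congˡ w (eval-z^ k))

  eval≉0 : ∀ {n} (s : Vec ℕ⁺ n) {z} → z ∈ Enumeration.elements (lectureHallPoints s) →
           ¬ IsZero (derangementPolynomial s) w
  eval≉0 s z∈ (e , f) = lectureHallPoint s z∈ (M.trans
    (M.sym (value-derangementPolynomial (λ p → eval p w) M.refl (λ p q → eval-⊕ p q w) eval-z^ s))
    (e +i f))

-- Real-rootedness and conclusion

derangementPolynomial-realRooted : ∀ {n} (s : Vec ℕ⁺ n) → RealRooted (derangementPolynomial s)
derangementPolynomial-realRooted {n} s =
  -- An empty enumeration gives the zero polynomial. Otherwise a zero `w` can have neither Im w > 0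
  -- nor, by conjugation, Im w < 0.
  Sum.map₁ rooted (inhabited? (Enumeration.elements (lectureHallPoints s)))
  where
  p = derangementPolynomial s
  inhabited? : (zs : List (Vec ℤ (suc n))) → (∃ λ z → z ∈ zs) ⊎
    (∀ k → coeff (List.foldr (λ z p → (z^ ℤ.∣ Vec.last z ∣) ⊕ p) [] zs) k ≡ 0)
  inhabited? []       = inj₂ λ _ → refl
  inhabited? (z ∷ zs) = inj₁ (z , here refl)
  rooted : (∃ λ z → z ∈ Enumeration.elements (lectureHallPoints s)) →
           ∀ w → IsZero p w → im w ≈ 0ℝ
  rooted (z , z∈) w (e , f) = ≤0∧-≤0⇒≈0
    (≮⇒≤0 λ 0<im → UpperHalfPlane.eval≉0 w 0<im s z∈ (e , f))
    (≮⇒≤0 λ 0<-im → UpperHalfPlane.eval≉0 (conj w) 0<-im s z∈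
      ( ≈-trans (re-≈ (eval-conj p w)) e
      , ≈-trans (im-≈ (eval-conj p w)) (≈-trans (-‿cong f) (pointwise λ _ → refl)) ))

theorem3p6 : ∀ (n : ℕ) (s : Vec ℕ⁺ n) →
    RealRooted (derangementPolynomial s) ×
    LogConcave (derangementPolynomial s) ×
    Unimodal (derangementPolynomial s)
theorem3p6 n s =
    derangementPolynomial-realRooted s
  , Coefficients.decreasing⇒logConcave p r
  , Coefficients.decreasing⇒unimodal p r
  where
  p = derangementPolynomial s
  r = Coefficients.derangement-decreasing s
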